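{- Let $H=(E,\{X_i:i\in[n]\})$ be a hypergraph and $t_1,\dots,t_n$ integers with $0\le t_i\le|X_i|$ satisfying: (H2) $|X_i\cap X_j|\le1$ for all distinct $i,j$; (H3) there are no $a,b,c\in E$ with $\{a,b\},\{a,c\},\{b,c\}$ all hyperedges; (T) for each $i$, either $t_i=1$ or $\min\{w(e):e\in X_i\}\le t_i<|X_i|$. Let $\rho(A)=\sum_{i=1}^n\min\{|A\cap X_i|,t_i\}$ for $A\subseteq E$. Let $\sigma$ be any polymatroid on $E$ such that $\sigma(A)=\rho(A)$ for every $A\subseteq E$ satisfying at least one of: (a) $|A|\le3$; (b) $|A|=4$ and there are three hyperedges $X_h,X_i,X_j$ with $t_h=t_i=t_j=1$ such that some element of $A$ lies in exactly one of these three hyperedges and each of the other three elements of $A$ lies in exactly two of them; (c) $A\subseteq X_i$ and $|A|\le t_i+1$ for some $i\in[n]$; (d) $A\subseteq X_i\triangle X_j$ for some $i,j\in[n]$ with $X_i\cap X_j\ne\emptyset$, where $|A\cap X_i|\le t_i$ and $|A\cap X_j|\le t_j$. Then, for each positive integer $k$, from every element of $\Delta_\sigma^k$ one can construct a proper $k$-coloring $c$ of the line graph $G_H$, and this coloring satisfies $\sigma(E)\ge c_1+2c_2^+$. If $\sigma=\rho$, then the image of the map $\phi$ (defined below) on proper $k$-colorings of $G_H$ is exactly $\Delta_\rho^k$. If $\sigma(E)<\chi(G_H)$, then $\sigma$ is indecomposable.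
   Context: A polymatroid on a finite set $E$ is a function $\rho:2^E\to\mathbb{Z}$ that is normalized, non-decreasing and submodular. A hypergraph is $H=(E,\mathcal{E})$ with $E$ finite and $\mathcal{E}=\{X_i:i\in[n]\}$ a set of nonempty subsets of $E$; $w(e)$ is the number of hyperedges containing $e$; $\triangle$ is symmetric difference. The line graph $G_H$ has vertex set $[n]$ with $ij$ an edge iff $i\ne j$ and $X_i\cap X_j\ne\emptyset$. For a proper $k$-coloring $c:[n]\to[k]$, $c_1$ (resp. $c_2^+$) is the number of $i\in[k]$ with $|c^{ -1}(i)|=1$ (resp. $\ge2$). $\Delta_\sigma^k$ is the set of $k$-tuples $(N_1,\dots,N_k)$ of matroids on $E$ with $\sigma=r_{N_1}+\cdots+r_{N_k}$. A polymatroid is indecomposable if it is not a sum of rank functions of finitely many matroids on $E$. The map $\phi$ sends a proper $k$-coloring $c$ to $(N_1,\dots,N_k)$ with $N_i=\bigl(\bigoplus_{h:c(h)=i}U_{t_h,X_h}\bigr)\oplus U_{0,Y}$, $Y=E-\bigcup_{h:c(h)=i}X_h$, where $U_{r,X}$ is the rank-$r$ uniform matroid on $X$. -}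

module Defs where

import Algebra.Properties.CommutativeMonoid.Sum
open import Data.Fin using (Fin; _≟_)
open import Data.Fin.Subset
open import Data.Fin.Subset.Properties
open import Data.Integer as ℤ using (ℤ; +_)
open import Data.List using (List; []; _∷_; length; filter; map; allFin)
import Data.List.Extrema.Nat as Extrema
open import Data.List.Relation.Unary.All as All using (All; []; _∷_)
import Data.List.Relation.Unary.All.Properties as All
open import Data.List.Relation.Unary.AllPairs as AllPairs using (AllPairs; []; _∷_)
import Data.List.Relation.Unary.AllPairs.Properties as AllPairs
open import Data.List.Relation.Unary.Unique.Propositional using (Unique)
import Data.List.Relation.Unary.Unique.Propositional.Properties as Unique
open import Data.Nat using (ℕ; suc; _+_; _≤_; _<_; _⊓_; z≤n; _≤?_)
import Data.Nat as ℕ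
open import Data.Nat.Properties hiding (_≟_; _≤?_)
open import Data.Product using (Σ; ∃-syntax; _×_; _,_; proj₁; proj₂)
open import Data.Sum using (_⊎_; inj₁; inj₂)
open import Data.Vec using ([]; _∷_)
open import Function using (_∘_)
open import Function.Definitions using (Injective)
open import Relation.Binary.PropositionalEquality
open import Relation.Nullary using (¬_; yes; no)
open import Relation.Unary using (Pred; Decidable)

private
  variable
    m n k : ℕ

-- The ground set E is Fin m, with subsets Subset m, and E itself is ⊤.

open Algebra.Properties.CommutativeMonoid.Sum +-0-commutativeMonoid public
  using (sum)

count : ∀ {p} {P : Pred (Fin n) p} → Decidable P → ℕ
count {n = n} P? = length (filter P? (allFin n))

infixl 6 _△_

_△_ : Subset m → Subset m → Subset m
A △ B = (A ─ B) ∪ (B ─ A)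

record IsPolymatroid (ρ : Subset m → ℤ) : Set where
  field
    normalized    : ρ ⊥ ≡ + 0
    nondecreasing : ∀ {A B} → A ⊆ B → ρ A ℤ.≤ ρ B
    submodular    : ∀ A B → ρ (A ∪ B) ℤ.+ ρ (A ∩ B) ℤ.≤ ρ A ℤ.+ ρ B

-- A matroid with ground set G ⊆ E, given by its rank function.  The values of
-- rank outside the subsets of G are unconstrained and carry no meaning.
record Matroid (G : Subset m) : Set where
  field
    rank          : Subset m → ℕ
    rank≤size     : ∀ {A} → A ⊆ G → rank A ≤ ∣ A ∣
    nondecreasing : ∀ {A B} → A ⊆ B → B ⊆ G → rank A ≤ rank B
    submodular    : ∀ {A B} → A ⊆ G → B ⊆ G →
                    rank (A ∪ B) + rank (A ∩ B) ≤ rank A + rank B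

open Matroid public using (rank)

infix 4 _≈ᴹ_

_≈ᴹ_ : {G : Subset m} → Matroid G → Matroid G → Set
_≈ᴹ_ {G = G} M N = ∀ {A} → A ⊆ G → rank M A ≡ rank N A

∣p∪q∣+∣p∩q∣ : (p q : Subset m) → ∣ p ∪ q ∣ + ∣ p ∩ q ∣ ≡ ∣ p ∣ + ∣ q ∣
∣p∪q∣+∣p∩q∣ []            []            = refl
∣p∪q∣+∣p∩q∣ (outside ∷ p) (outside ∷ q) = ∣p∪q∣+∣p∩q∣ p q
∣p∪q∣+∣p∩q∣ (inside  ∷ p) (outside ∷ q) = cong suc (∣p∪q∣+∣p∩q∣ p q)
∣p∪q∣+∣p∩q∣ (outside ∷ p) (inside  ∷ q) =
  trans (cong suc (∣p∪q∣+∣p∩q∣ p q)) (sym (+-suc ∣ p ∣ ∣ q ∣))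
∣p∪q∣+∣p∩q∣ (inside  ∷ p) (inside  ∷ q) =
  cong suc (trans (+-suc ∣ p ∪ q ∣ ∣ p ∩ q ∣)
                  (trans (cong suc (∣p∪q∣+∣p∩q∣ p q)) (sym (+-suc ∣ p ∣ ∣ q ∣))))

private
  ⊓-submodular : ∀ r {a b u v} → u + v ≡ a + b → v ≤ a → v ≤ b →
                 u ⊓ r + v ⊓ r ≤ a ⊓ r + b ⊓ r
  ⊓-submodular r {a} {b} {u} {v} e v≤a v≤b with r ≤? a | r ≤? b
  ... | yes r≤a | _ = +-mono-≤
        (≤-trans (m⊓n≤n u r) (≤-reflexive (sym (m≥n⇒m⊓n≡n r≤a))))
        (⊓-monoˡ-≤ r v≤b)
  ... | no _ | yes r≤b = ≤-trans (+-mono-≤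
        (≤-trans (m⊓n≤n u r) (≤-reflexive (sym (m≥n⇒m⊓n≡n r≤b))))
        (⊓-monoˡ-≤ r v≤a)) (≤-reflexive (+-comm (b ⊓ r) (a ⊓ r)))
  ... | no r≰a | no r≰b = ≤-trans (+-mono-≤ (m⊓n≤m u r) (m⊓n≤m v r))
        (≤-reflexive (trans e (sym (cong₂ _+_
          (m≤n⇒m⊓n≡m (<⇒≤ (≰⇒> r≰a))) (m≤n⇒m⊓n≡m (<⇒≤ (≰⇒> r≰b)))))))

uniform : (r : ℕ) (X : Subset m) → r ≤ ∣ X ∣ → Matroid X
uniform r X _ = record
  { rank          = λ A → ∣ A ∣ ⊓ r
  ; rank≤size     = λ {A} _ → m⊓n≤m ∣ A ∣ r
  ; nondecreasing = λ A⊆B _ → ⊓-monoˡ-≤ r (p⊆q⇒∣p∣≤∣q∣ A⊆B)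
  ; submodular    = λ {A} {B} _ _ → ⊓-submodular r (∣p∪q∣+∣p∩q∣ A B)
                      (∣p∩q∣≤∣p∣ A B) (∣p∩q∣≤∣q∣ A B)
  }

private
  restrict-⊆ : {A B : Subset m} (G : Subset m) → A ⊆ B → A ∩ G ⊆ B ∩ G
  restrict-⊆ {A = A} G A⊆B x∈ =
    let x∈A , x∈G = x∈p∩q⁻ A G x∈ in x∈p∩q⁺ (A⊆B x∈A , x∈G)

  restrict-submodular : {G : Subset m} (M : Matroid G) (A B : Subset m) →
    rank M ((A ∪ B) ∩ G) + rank M ((A ∩ B) ∩ G) ≤ rank M (A ∩ G) + rank M (B ∩ G)
  restrict-submodular {G = G} M A B =
    subst (_≤ rank M (A ∩ G) + rank M (B ∩ G))
      (cong₂ (λ S T → rank M S + rank M T) (sym (∩-distribʳ-∪ G A B)) ∩-eq)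
      (Matroid.submodular M (p∩q⊆q A G) (p∩q⊆q B G))
    where
    ∩-eq : (A ∩ G) ∩ (B ∩ G) ≡ (A ∩ B) ∩ G
    ∩-eq = ⊆-antisym
      (λ x∈ → let x∈AG , x∈BG = x∈p∩q⁻ (A ∩ G) (B ∩ G) x∈
                  x∈A , x∈G = x∈p∩q⁻ A G x∈AG
                  x∈B , _ = x∈p∩q⁻ B G x∈BG
              in x∈p∩q⁺ (x∈p∩q⁺ (x∈A , x∈B) , x∈G))
      (λ x∈ → let x∈AB , x∈G = x∈p∩q⁻ (A ∩ B) G x∈
                  x∈A , x∈B = x∈p∩q⁻ A B x∈AB
              in x∈p∩q⁺ (x∈p∩q⁺ (x∈A , x∈G) , x∈p∩q⁺ (x∈B , x∈G)))

  disjoint-size : {G G′ : Subset m} → Empty (G ∩ G′) → (A : Subset m) →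
                  ∣ A ∩ G ∣ + ∣ A ∩ G′ ∣ ≤ ∣ A ∣
  disjoint-size {m} {G} {G′} disj A = begin
    ∣ A ∩ G ∣ + ∣ A ∩ G′ ∣                          ≡⟨ ∣p∪q∣+∣p∩q∣ (A ∩ G) (A ∩ G′) ⟨
    ∣ A ∩ G ∪ A ∩ G′ ∣ + ∣ (A ∩ G) ∩ (A ∩ G′) ∣     ≡⟨ cong (λ z → ∣ A ∩ G ∪ A ∩ G′ ∣ + z) empty ⟩
    ∣ A ∩ G ∪ A ∩ G′ ∣ + 0                          ≡⟨ +-identityʳ _ ⟩
    ∣ A ∩ G ∪ A ∩ G′ ∣                              ≤⟨ p⊆q⇒∣p∣≤∣q∣ sub ⟩
    ∣ A ∣                                           ∎
    where
    open ≤-Reasoning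
    empty : ∣ (A ∩ G) ∩ (A ∩ G′) ∣ ≡ 0
    empty = trans (cong ∣_∣ (Empty-unique λ (x , x∈) →
      let x∈AG , x∈AG′ = x∈p∩q⁻ (A ∩ G) (A ∩ G′) x∈
      in disj (x , x∈p∩q⁺ (proj₂ (x∈p∩q⁻ A G x∈AG) , proj₂ (x∈p∩q⁻ A G′ x∈AG′)))))
      (∣⊥∣≡0 m)
    sub : A ∩ G ∪ A ∩ G′ ⊆ A
    sub x∈ with x∈p∪q⁻ (A ∩ G) (A ∩ G′) x∈
    ... | inj₁ x∈AG  = p∩q⊆p A G x∈AG
    ... | inj₂ x∈AG′ = p∩q⊆p A G′ x∈AG′

directSum : {G G′ : Subset m} → Matroid G → Matroid G′ → Empty (G ∩ G′) →
            Matroid (G ∪ G′)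
directSum {G = G} {G′} M N disj = record
  { rank          = λ A → rank M (A ∩ G) + rank N (A ∩ G′)
  ; rank≤size     = λ {A} _ → ≤-trans
      (+-mono-≤ (Matroid.rank≤size M (p∩q⊆q A G)) (Matroid.rank≤size N (p∩q⊆q A G′)))
      (disjoint-size disj A)
  ; nondecreasing = λ {A} {B} A⊆B _ → +-mono-≤
      (Matroid.nondecreasing M (restrict-⊆ G A⊆B) (p∩q⊆q B G))
      (Matroid.nondecreasing N (restrict-⊆ G′ A⊆B) (p∩q⊆q B G′))
  ; submodular    = λ {A} {B} _ _ → begin
      (rank M ((A ∪ B) ∩ G) + rank N ((A ∪ B) ∩ G′))
        + (rank M ((A ∩ B) ∩ G) + rank N ((A ∩ B) ∩ G′))
        ≡⟨ interchange (rank M ((A ∪ B) ∩ G)) _ _ _ ⟩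
      (rank M ((A ∪ B) ∩ G) + rank M ((A ∩ B) ∩ G))
        + (rank N ((A ∪ B) ∩ G′) + rank N ((A ∩ B) ∩ G′))
        ≤⟨ +-mono-≤ (restrict-submodular M A B) (restrict-submodular N A B) ⟩
      (rank M (A ∩ G) + rank M (B ∩ G)) + (rank N (A ∩ G′) + rank N (B ∩ G′))
        ≡⟨ interchange (rank M (A ∩ G)) _ _ _ ⟩
      (rank M (A ∩ G) + rank N (A ∩ G′)) + (rank M (B ∩ G) + rank N (B ∩ G′)) ∎
  }
  where
  open ≤-Reasoning
  interchange : ∀ a b c d → (a + b) + (c + d) ≡ (a + c) + (b + d)
  interchange a b c d = begin-equality
    (a + b) + (c + d) ≡⟨ +-assoc a b (c + d) ⟩
    a + (b + (c + d)) ≡⟨ cong (λ z → a + z) (trans (sym (+-assoc b c d))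
                           (trans (cong (_+ d) (+-comm b c)) (+-assoc c b d))) ⟩
    a + (c + (b + d)) ≡⟨ +-assoc a c (b + d) ⟨
    (a + c) + (b + d) ∎

PairwiseDisjoint : (Fin n → Subset m) → List (Fin n) → Set
PairwiseDisjoint X = AllPairs (λ h j → Empty (X h ∩ X j))

disjoint-⋃ : (X : Fin n → Subset m) {h : Fin n} {hs : List (Fin n)} →
             All (λ j → Empty (X h ∩ X j)) hs → Empty (X h ∩ ⋃ (map X hs))
disjoint-⋃ X {h} [] (x , x∈) = ∉⊥ (proj₂ (x∈p∩q⁻ (X h) ⊥ x∈))
disjoint-⋃ X {h} {j ∷ hs} (d ∷ ds) (x , x∈) with x∈p∩q⁻ (X h) _ x∈
... | x∈h , x∈∪ with x∈p∪q⁻ (X j) (⋃ (map X hs)) x∈∪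
...   | inj₁ x∈j = d (x , x∈p∩q⁺ (x∈h , x∈j))
...   | inj₂ x∈⋃ = disjoint-⋃ X ds (x , x∈p∩q⁺ (x∈h , x∈⋃))

⨁ : {X : Fin n → Subset m} → (∀ h → Matroid (X h)) →
    (hs : List (Fin n)) → PairwiseDisjoint X hs → Matroid (⋃ (map X hs))
⨁         M []       []       = uniform 0 ⊥ z≤n
⨁ {X = X} M (h ∷ hs) (d ∷ ds) = directSum (M h) (⨁ M hs ds) (disjoint-⋃ X d)

castGround : {G G′ : Subset m} → G ≡ G′ → Matroid G → Matroid G′
castGround {m} {G} {G′} eq M = record
  { rank          = rank M
  ; rank≤size     = λ {A} A⊆ → Matroid.rank≤size M (back A A⊆)
  ; nondecreasing = λ {A} {B} A⊆B B⊆ → Matroid.nondecreasing M A⊆B (back B B⊆)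
  ; submodular    = λ {A} {B} A⊆ B⊆ → Matroid.submodular M (back A A⊆) (back B B⊆)
  }
  where
  back : (A : Subset m) → A ⊆ G′ → A ⊆ G
  back A A⊆ x∈ = subst (_ ∈_) (sym eq) (A⊆ x∈)

infix 4 _∈Δ_

_∈Δ_ : (Fin k → Matroid {m} ⊤) → (Subset m → ℤ) → Set
N ∈Δ σ = ∀ A → σ A ≡ + sum (λ l → rank (N l) A)

Indecomposable : (Subset m → ℤ) → Set
Indecomposable {m} σ = ¬ (∃[ k ] Σ (Fin k → Matroid {m} ⊤) λ N → N ∈Δ σ)

record Graph (n : ℕ) : Set₁ where
  field
    Adj       : Fin n → Fin n → Set
    symmetric : ∀ {i j} → Adj i j → Adj j i
    loopless  : ∀ {i} → ¬ Adj i i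

record ProperColouring (G : Graph n) (k : ℕ) : Set where
  field
    colour : Fin n → Fin k
    proper : ∀ {i j} → Graph.Adj G i j → colour i ≢ colour j

  class : Fin k → List (Fin n)
  class l = filter (λ i → colour i ≟ l) (allFin n)

  c₁ : ℕ
  c₁ = count (λ l → length (class l) ℕ.≟ 1)

  c₂⁺ : ℕ
  c₂⁺ = count (λ l → 2 ≤? length (class l))

IsChromaticNumber : Graph n → ℕ → Set
IsChromaticNumber G χ = ProperColouring G χ × (∀ k → ProperColouring G k → χ ≤ k)

-- The hyperedges form a set indexed without repetition, so X is injective.
record Hypergraph (m n : ℕ) : Set where
  field
    X           : Fin n → Subset m
    X-nonempty  : ∀ i → Nonempty (X i)
    X-injective : Injective _≡_ _≡_ X

module _ (H : Hypergraph m n) where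
  open Hypergraph H

  IsHyperedge : Subset m → Set
  IsHyperedge S = ∃[ i ] X i ≡ S

  degreeIn : List (Fin n) → Fin m → ℕ
  degreeIn is e = length (filter (λ i → e ∈? X i) is)

  w : Fin m → ℕ
  w = degreeIn (allFin n)

  lineGraph : Graph n
  lineGraph = record
    { Adj       = λ i j → i ≢ j × Nonempty (X i ∩ X j)
    ; symmetric = λ {i} {j} (i≢j , ne) → i≢j ∘ sym , subst Nonempty (∩-comm (X i) (X j)) ne
    ; loopless  = λ (i≢i , _) → i≢i refl
    }

  -- The default value n is harmless: X i is nonempty and w never exceeds n.
  minDegree : Fin n → ℕ
  minDegree i = Extrema.min n (map w (filter (_∈? X i) (allFin m)))

  H2 : Set
  H2 = ∀ i j → i ≢ j → ∣ X i ∩ X j ∣ ≤ 1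

  H3 : Set
  H3 = ¬ (∃[ a ] ∃[ b ] ∃[ c ] a ≢ b × a ≢ c × b ≢ c ×
          IsHyperedge (⁅ a ⁆ ∪ ⁅ b ⁆) × IsHyperedge (⁅ a ⁆ ∪ ⁅ c ⁆) ×
          IsHyperedge (⁅ b ⁆ ∪ ⁅ c ⁆))

  module _ (t : Fin n → ℕ) where

    CondT : Set
    CondT = ∀ i → t i ≡ 1 ⊎ (minDegree i ≤ t i × t i < ∣ X i ∣)

    ρ : Subset m → ℤ
    ρ A = + sum (λ i → ∣ A ∩ X i ∣ ⊓ t i)

    data Prescribed (A : Subset m) : Set where
      size≤3   : ∣ A ∣ ≤ 3 → Prescribed A
      triangle : ∣ A ∣ ≡ 4 → (h i j : Fin n) → h ≢ i → h ≢ j → i ≢ j →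
                 t h ≡ 1 → t i ≡ 1 → t j ≡ 1 →
                 (d : Fin m) → d ∈ A → degreeIn (h ∷ i ∷ j ∷ []) d ≡ 1 →
                 (∀ {x} → x ∈ A → x ≢ d → degreeIn (h ∷ i ∷ j ∷ []) x ≡ 2) →
                 Prescribed A
      inEdge   : (i : Fin n) → A ⊆ X i → ∣ A ∣ ≤ t i + 1 → Prescribed A
      twoEdges : (i j : Fin n) → Nonempty (X i ∩ X j) → A ⊆ X i △ X j →
                 ∣ A ∩ X i ∣ ≤ t i → ∣ A ∩ X j ∣ ≤ t j → Prescribed A

  class-disjoint : (c : ProperColouring lineGraph k) (l : Fin k) →
                   PairwiseDisjoint X (ProperColouring.class c l)
  class-disjoint c l = go (AllPairs.filter⁺ l? (Unique.allFin⁺ n)) (All.all-filter l? (allFin n))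
    where
    open ProperColouring c
    l? : Decidable (λ i → colour i ≡ l)
    l? i = colour i ≟ l
    go : ∀ {hs} → Unique hs → All (λ i → colour i ≡ l) hs → PairwiseDisjoint X hs
    go []       []       = []
    go (u ∷ us) (e ∷ es) =
      All.zipWith (λ (h≢j , e′) ne → proper (h≢j , ne) (trans e (sym e′))) (u , es) ∷ go us es

  φ : (t : Fin n → ℕ) → (∀ i → t i ≤ ∣ X i ∣) →
      ProperColouring lineGraph k → Fin k → Matroid {m} ⊤
  φ t t≤ c l = castGround (p∪∁p≡⊤ Z)
    (directSum (⨁ (λ h → uniform (t h) (X h) (t≤ h)) hs (class-disjoint c l))
               (uniform 0 (∁ Z) z≤n)
               (λ (x , x∈) → let x∈Z , x∈∁Z = x∈p∩q⁻ Z (∁ Z) x∈ in x∈∁p⇒x∉p x∈∁Z x∈Z))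
    where
    hs : List (Fin n)
    hs = ProperColouring.class c l
    Z : Subset m
    Z = ⋃ (map X hs)

{-# OPTIONS --safe #-}

-- Let σ = r₁ + ⋯ + rₖ, and let dₗ be the nullity function of Nₗ after discarding its loops.  On the
-- prescribed sets A the equation σ(A) = ρ(A) says Σₗ dₗ(A) = Σᵢ max(|A ∩ Xᵢ| - tᵢ, 0).  Hence each
-- (tᵢ + 1)-subset of Xᵢ is a circuit of exactly one Nₗ; by pigeonhole this l is the same for
-- all of them, and it is the colour of i.  (If |Xᵢ| = tᵢ = 1, any colour in which Xᵢ is not a loop and
-- which no other edge through Xᵢ uses will do.)  If two intersecting edges had the same colour l,
-- eliminating the common element would give Nₗ a circuit in Xᵢ △ Xⱼ, and comparing nullities a pair of
-- parallel elements joining Xᵢ to Xⱼ, which is excluded by (a), (b), (d) and (H3).  Finally Nₗ is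
-- bounded by the direct sum of the uniform matroids of its colour class, with equality if σ = ρ.
module Submission where

open import Defs
open import Data.Nat using (ℕ; _+_; _*_; _≤_; _<_)
open import Data.Fin using (Fin)
open import Data.Fin.Subset using (Subset; ⊤; ∣_∣)
open import Data.Product using (∃-syntax; _×_)
open import Function.Bundles using (_⇔_)
open import Relation.Binary.PropositionalEquality using (_≡_)
open Hypergraph using (X)

import Algebra.Properties.CommutativeMonoid.Sum
open import Data.Bool using (if_then_else_)
import Data.Empty as Empty
open import Data.Fin as Fin using (zero; suc)
open import Data.Fin.Properties using () renaming (suc-injective to Fin-suc-injective)
open import Data.Fin.Subset hiding (Subset; ⊤; ∣_∣)
open import Data.Fin.Subset.Properties
open import Data.List as List using (List; []; _∷_; filter; tabulate; allFin)
import Data.List.Extrema.Nat as Extrema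
import Data.List.Membership.Propositional as Membership
open import Data.List.Membership.Propositional.Properties
  using (∈-allFin; ∈-filter⁺; ∈-filter⁻; ∈-length; ∈-map⁻)
open import Data.List.Membership.Setoid.Properties using (index-injective)
open import Data.List.Properties using (filter-accept; filter-reject; length-filter; length-tabulate)
open import Data.List.Relation.Unary.All as All using ([]; _∷_)
import Data.List.Relation.Unary.All.Properties as AllProperties
open import Data.List.Relation.Unary.AllPairs using ([]; _∷_)
import Data.List.Relation.Unary.Any as Any
open import Data.List.Relation.Unary.Unique.Propositional using (Unique)
import Data.List.Relation.Unary.Unique.Propositional.Properties as Unique
open import Data.Nat using (zero; suc; _∸_; _⊓_; z≤n; s≤s; s≤s⁻¹)
import Data.Nat.ListAction as ListAction
open import Data.Nat.Properties
open import Data.Nat.Tactic.RingSolver using (solve-∀)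
open import Data.Product using (_,_; proj₁; proj₂)
open import Data.Sum as Sum using (_⊎_; inj₁; inj₂)
open import Data.Vec using ([]; _∷_; here; there)
open import Function using (_∘_; const; id)
open import Function.Bundles using (mk⇔)
open import Relation.Binary.PropositionalEquality hiding (_≡_)
open import Relation.Nullary using (¬_; Dec; yes; no; does; contradiction)
open import Relation.Nullary.Decidable using (_×-dec_)
open import Relation.Unary using (Decidable)

open Algebra.Properties.CommutativeMonoid.Sum +-0-commutativeMonoid
  using (∑-distrib-+; ∑-comm; sum-cong-≗; sum-replicate-zero)

-- The equation for σ constrains only sums over all colours, never a single `N l`. What is known of
-- one colour is therefore obtained by counting: lower bounds whose total exceeds what the equation
-- allows must collide in one colour or contradict each other. Nullity is counted instead of rank
-- because it is monotone and supermodular, so lower bounds pass to larger sets and add up.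
-- Discarding loops makes the modular parts of both sides cancel: the ranks of a singleton e add up
-- to its degree w(e). The main obstacle is that few sets are prescribed. For t_i ≥ 2, a set of t_i
-- + 2 elements of X_i need not be, and there the bound min w ≤ t_i of (T) takes over, since an
-- element e is a loop in all but w(e) of the matroids.

private
  variable
    k m n : ℕ

-- A linear-arithmetic certificate: u ≤ v is the sum of the hypotheses, r the slack.
linear : ∀ {p q u v} r → u ≤ v → p + v + r ≡ q + u → p ≤ q
linear {p} {q} {u} {v} r u≤v eq = +-cancelʳ-≤ v p q (begin
  p + v      ≤⟨ m≤m+n (p + v) r ⟩
  p + v + r  ≡⟨ eq ⟩
  q + u      ≤⟨ +-monoʳ-≤ q u≤v ⟩
  q + v      ∎)
  where open ≤-Reasoning

-- Sums over finite index sets and double counting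

sum-mono : {f g : Fin n → ℕ} → (∀ i → f i ≤ g i) → sum f ≤ sum g
sum-mono {zero}  _   = z≤n
sum-mono {suc _} f≤g = +-mono-≤ (f≤g zero) (sum-mono (f≤g ∘ suc))

sum-mono-< : {f g : Fin n → ℕ} → (∀ i → f i ≤ g i) → ∀ i → f i < g i → sum f < sum g
sum-mono-< f≤g zero    f<g = +-mono-<-≤ f<g (sum-mono (f≤g ∘ suc))
sum-mono-< f≤g (suc i) f<g = +-mono-≤-< (f≤g zero) (sum-mono-< (f≤g ∘ suc) i f<g)

-- Turns an inequality in each colour into an equality once the totals agree; this settles both the
-- loops and the case σ = ρ.
sum-tight : {f g : Fin n → ℕ} → (∀ i → f i ≤ g i) → sum g ≤ sum f → ∀ i → f i ≡ g i
sum-tight f≤g ∑g≤∑f i =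
  ≤-antisym (f≤g i) (≮⇒≥ λ f<g → <⇒≱ (sum-mono-< f≤g i f<g) ∑g≤∑f)

term≤sum : (f : Fin n → ℕ) → ∀ i → f i ≤ sum f
term≤sum f zero    = m≤m+n _ _
term≤sum f (suc i) = ≤-trans (term≤sum (f ∘ suc) i) (m≤n+m _ _)

sum-<⇒∃ : (f g : Fin n → ℕ) → sum f < sum g → ∃[ i ] f i < g i
sum-<⇒∃ {suc n} f g ∑f<∑g with f zero <? g zero
... | yes f<g = zero , f<g
... | no f≮g  =
  let i , f<g = sum-<⇒∃ (f ∘ suc) (g ∘ suc)
                  (+-cancelˡ-< (g zero) _ _ (≤-<-trans (+-monoˡ-≤ _ (≮⇒≥ f≮g)) ∑f<∑g))
  in suc i , f<g

sum-∸ : (f g : Fin n → ℕ) → (∀ i → g i ≤ f i) → sum (λ i → f i ∸ g i) + sum g ≡ sum f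
sum-∸ f g g≤f =
  trans (sym (∑-distrib-+ (λ i → f i ∸ g i) g)) (sum-cong-≗ λ i → m∸n+n≡m (g≤f i))

sum-pos : (f : Fin n → ℕ) → 0 < sum f → ∃[ i ] 0 < f i
sum-pos {suc n} f 0<∑f with f zero in eq
... | suc _ = zero , subst (0 <_) (sym eq) (s≤s z≤n)
... | zero  = let i , 0<f = sum-pos (f ∘ suc) 0<∑f in suc i , 0<f

sum-two : (f : Fin n → ℕ) (b : ℕ) → (∀ i → f i ≤ b) → b < sum f →
          ∃[ i ] ∃[ j ] i ≢ j × 0 < f i × 0 < f j
sum-two {suc n} f b f≤b b<∑f with f zero in eq
... | zero =
  let i , j , i≢j , 0<fi , 0<fj = sum-two (f ∘ suc) b (f≤b ∘ suc) b<∑f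
  in suc i , suc j , (i≢j ∘ Fin-suc-injective) , 0<fi , 0<fj
... | suc c =
  let j , 0<fj = sum-pos (f ∘ suc) (+-cancelˡ-< (suc c) 0 _
                   (subst (_< suc c + sum (f ∘ suc)) (sym (+-identityʳ (suc c)))
                     (≤-<-trans (subst (_≤ b) eq (f≤b zero)) b<∑f)))
  in zero , suc j , (λ ()) , subst (0 <_) (sym eq) (s≤s z≤n) , 0<fj

sum≤bound : (f : Fin n → ℕ) (b : ℕ) → (∀ i → f i ≤ b) →
            (∀ {i j} → i ≢ j → 0 < f i → ¬ 0 < f j) → sum f ≤ b
sum≤bound f b f≤b single = ≮⇒≥ λ b<∑f →
  let i , j , i≢j , 0<fi , 0<fj = sum-two f b f≤b b<∑f in single i≢j 0<fi 0<fj

-- Exchanging the order of summation yields a row whose total exceeds its capacity `b l`; a single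
-- entry cannot do that, so two are positive.
collision : (F : Fin k → Fin n → ℕ) (b : Fin k → ℕ) → (∀ l i → F l i ≤ b l) →
            sum b < sum (λ i → sum (λ l → F l i)) →
            ∃[ l ] ∃[ i ] ∃[ j ] i ≢ j × 0 < F l i × 0 < F l j
collision F b F≤b ∑b<∑∑F =
  let l , b<∑F = sum-<⇒∃ b (λ l → sum (F l))
                   (subst (sum b <_) (sym (∑-comm F)) ∑b<∑∑F)
      i , j , rest = sum-two (F l) (b l) (F≤b l) b<∑F
  in l , i , j , rest

∑[_] : {A : Set} → (A → ℕ) → List A → ℕ
∑[ f ] is = ListAction.sum (List.map f is)

𝟙 : {P : Set} → Dec P → ℕ
𝟙 P? = if does P? then 1 else 0

𝟙-pos⁺ : {P : Set} (P? : Dec P) → P → 0 < 𝟙 P?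
𝟙-pos⁺ (yes _) _ = s≤s z≤n
𝟙-pos⁺ (no ¬p) p = contradiction p ¬p

𝟙-pos⁻ : {P : Set} (P? : Dec P) → 0 < 𝟙 P? → P
𝟙-pos⁻ (yes p) _ = p

𝟙≤ : {P : Set} {b : ℕ} (P? : Dec P) → (P → 1 ≤ b) → 𝟙 P? ≤ b
𝟙≤ (yes p) P⇒ = P⇒ p
𝟙≤ (no _)  _  = z≤n

private
  erase : Fin n → (Fin n → ℕ) → Fin n → ℕ
  erase i f j = if does (i Data.Fin.≟ j) then 0 else f j

  sum-erase : (f : Fin n → ℕ) → ∀ i → sum f ≡ f i + sum (erase i f)
  sum-erase f zero    = refl
  sum-erase f (suc i) = trans (cong (f zero +_) (sum-erase (f ∘ suc) i))
    (solve (f zero) (f (suc i)) (sum (erase i (f ∘ suc))))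
    where
    solve : ∀ a b c → a + (b + c) ≡ b + (a + c)
    solve = solve-∀

-- Used to bound a sum over all colours or edges from below by a few distinct ones. Erasing the
-- head's term is harmless to the tail, which avoids that index.
sum-unique : (f : Fin n → ℕ) {is : List (Fin n)} → Unique is → ∑[ f ] is ≤ sum f
sum-unique f []                    = z≤n
sum-unique f {i ∷ is} (i∉is ∷ uniq) = begin
  f i + ∑[ f ] is          ≡⟨ cong (f i +_) (erased i∉is) ⟩
  f i + ∑[ erase i f ] is  ≤⟨ +-monoʳ-≤ (f i) (sum-unique (erase i f) uniq) ⟩
  f i + sum (erase i f)    ≡⟨ sum-erase f i ⟨
  sum f                    ∎
  where
  open ≤-Reasoning
  erased : ∀ {js} → All.All (i ≢_) js → ∑[ f ] js ≡ ∑[ erase i f ] js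
  erased []                      = refl
  erased (_∷_ {x = j} i≢j i∉js) with i Data.Fin.≟ j
  ... | yes i≡j = contradiction i≡j i≢j
  ... | no _    = cong (f j +_) (erased i∉js)

sum-single : (f : Fin n → ℕ) (i : Fin n) → (∀ j → j ≢ i → f j ≡ 0) → sum f ≡ f i
sum-single {suc n} f zero f≡0 = trans
  (cong (f zero +_) (trans (sum-cong-≗ λ j → f≡0 (suc j) λ ()) (sum-replicate-zero n)))
  (+-identityʳ (f zero))
sum-single f (suc i) f≡0 =
  cong₂ _+_ (f≡0 zero λ ()) (sum-single (f ∘ suc) i λ j j≢i → f≡0 (suc j) (j≢i ∘ Fin-suc-injective))

sum-at : (c : Fin k) (x : ℕ) → sum (λ l → if does (c Data.Fin.≟ l) then x else 0) ≡ x
sum-at c x = trans (sum-single _ c off) on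
  where
  off : ∀ l → l ≢ c → (if does (c Data.Fin.≟ l) then x else 0) ≡ 0
  off l l≢c with c Data.Fin.≟ l
  ... | yes c≡l = contradiction (sym c≡l) l≢c
  ... | no _    = refl
  on : (if does (c Data.Fin.≟ c) then x else 0) ≡ x
  on with c Data.Fin.≟ c
  ... | yes _   = refl
  ... | no c≢c  = contradiction refl c≢c

∑-filter : {P : Fin n → Set} (P? : Decidable P) (f : Fin n → ℕ) →
           ∑[ f ] (filter P? (allFin n)) ≡ sum (λ i → if does (P? i) then f i else 0)
∑-filter {n} P? f = go n (λ i → i)
  where
  go : ∀ r (g : Fin r → Fin n) → ∑[ f ] (filter P? (tabulate g)) ≡
                              sum (λ i → if does (P? (g i)) then f (g i) else 0)
  go zero    g = refl
  go (suc r) g with P? (g zero)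
  ... | yes _ = cong (f (g zero) +_) (go r (g ∘ suc))
  ... | no _  = go r (g ∘ suc)

length≡∑ : {A : Set} (xs : List A) → List.length xs ≡ ∑[ const 1 ] xs
length≡∑ []       = refl
length≡∑ (_ ∷ xs) = cong suc (length≡∑ xs)

count≡sum : {P : Fin n → Set} (P? : Decidable P) → count P? ≡ sum (λ i → 𝟙 (P? i))
count≡sum P? = trans (length≡∑ (filter P? (allFin _))) (∑-filter P? (const 1))

-- Finite sets

module _ {A B : Subset m} {x : Fin m} where
  ∈∩ : x ∈ A → x ∈ B → x ∈ A ∩ B
  ∈∩ x∈A x∈B = x∈p∩q⁺ (x∈A , x∈B)

  ∈∩₁ : x ∈ A ∩ B → x ∈ A
  ∈∩₁ = p∩q⊆p A B

  ∈∩₂ : x ∈ A ∩ B → x ∈ B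
  ∈∩₂ = p∩q⊆q A B

  ∈∪₁ : x ∈ A → x ∈ A ∪ B
  ∈∪₁ = p⊆p∪q B

  ∈∪₂ : x ∈ B → x ∈ A ∪ B
  ∈∪₂ = q⊆p∪q A B

  ∈─⁻ : x ∈ A ─ B → x ∉ B
  ∈─⁻ x∈ x∈B = go x∈ x∈B
    where
    go : ∀ {m} {A B : Subset m} {x} → x ∈ A ─ B → x ∉ B
    go {A = _ ∷ _} {outside ∷ _} here          ()
    go {A = _ ∷ _} {_ ∷ _}       (there x∈A─B) (there x∈B) = go x∈A─B x∈B

∪-elim : {A B C : Subset m} → A ⊆ C → B ⊆ C → A ∪ B ⊆ C
∪-elim {A = A} {B} A⊆C B⊆C x∈ with x∈p∪q⁻ A B x∈
... | inj₁ x∈A = A⊆C x∈A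
... | inj₂ x∈B = B⊆C x∈B

⁅⁆⊆ : {A : Subset m} {x : Fin m} → x ∈ A → ⁅ x ⁆ ⊆ A
⁅⁆⊆ {x = x} x∈A y∈ rewrite x∈⁅y⁆⇒x≡y x y∈ = x∈A

pair⊆ : {A : Subset m} {x y : Fin m} → x ∈ A → y ∈ A → ⁅ x ⁆ ∪ ⁅ y ⁆ ⊆ A
pair⊆ x∈A y∈A = ∪-elim (⁅⁆⊆ x∈A) (⁅⁆⊆ y∈A)

∈₁ : {x y : Fin m} → x ∈ ⁅ x ⁆ ∪ ⁅ y ⁆
∈₁ = ∈∪₁ (x∈⁅x⁆ _)

∈₂ : {x y : Fin m} → y ∈ ⁅ x ⁆ ∪ ⁅ y ⁆
∈₂ {x = x} = ∈∪₂ {A = ⁅ x ⁆} (x∈⁅x⁆ _)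

∈pair⁻ : {x y z : Fin m} → z ∈ ⁅ x ⁆ ∪ ⁅ y ⁆ → z ≡ x ⊎ z ≡ y
∈pair⁻ {x = x} {y} z∈ with x∈p∪q⁻ ⁅ x ⁆ ⁅ y ⁆ z∈
... | inj₁ z∈x = inj₁ (x∈⁅y⁆⇒x≡y x z∈x)
... | inj₂ z∈y = inj₂ (x∈⁅y⁆⇒x≡y y z∈y)

∣∪⁅⁆∣ : {A : Subset m} {x : Fin m} → x ∉ A → ∣ A ∪ ⁅ x ⁆ ∣ ≡ suc ∣ A ∣
∣∪⁅⁆∣ {m} {A} {x} x∉A = begin
  ∣ A ∪ ⁅ x ⁆ ∣                      ≡⟨ +-identityʳ _ ⟨
  ∣ A ∪ ⁅ x ⁆ ∣ + 0                  ≡⟨ cong (∣ A ∪ ⁅ x ⁆ ∣ +_) empty ⟨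
  ∣ A ∪ ⁅ x ⁆ ∣ + ∣ A ∩ ⁅ x ⁆ ∣      ≡⟨ ∣p∪q∣+∣p∩q∣ A ⁅ x ⁆ ⟩
  ∣ A ∣ + ∣ ⁅ x ⁆ ∣                  ≡⟨ cong (∣ A ∣ +_) (∣⁅x⁆∣≡1 x) ⟩
  ∣ A ∣ + 1                          ≡⟨ +-comm ∣ A ∣ 1 ⟩
  suc ∣ A ∣                          ∎
  where
  open ≡-Reasoning
  empty : ∣ A ∩ ⁅ x ⁆ ∣ ≡ 0
  empty = trans (cong ∣_∣ (Empty-unique λ (y , y∈) →
    x∉A (subst (_∈ A) (x∈⁅y⁆⇒x≡y x (∈∩₂ {A = A} y∈)) (∈∩₁ y∈)))) (∣⊥∣≡0 m)

∣pair∣ : {x y : Fin m} → x ≢ y → ∣ ⁅ x ⁆ ∪ ⁅ y ⁆ ∣ ≡ 2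
∣pair∣ {x = x} {y} x≢y =
  trans (∣∪⁅⁆∣ λ y∈ → x≢y (sym (x∈⁅y⁆⇒x≡y x y∈))) (cong suc (∣⁅x⁆∣≡1 x))

∪⁅⁆-absorb : {A : Subset m} {x : Fin m} → x ∈ A → A ∪ ⁅ x ⁆ ≡ A
∪⁅⁆-absorb x∈A = ⊆-antisym (∪-elim (λ y∈ → y∈) (⁅⁆⊆ x∈A)) ∈∪₁

∣∪⁅⁆∣≤ : (A : Subset m) (x : Fin m) → ∣ A ∪ ⁅ x ⁆ ∣ ≤ suc ∣ A ∣
∣∪⁅⁆∣≤ A x with x ∈? A
... | yes x∈A = ≤-trans (≤-reflexive (cong ∣_∣ (∪⁅⁆-absorb x∈A))) (n≤1+n _)
... | no x∉A  = ≤-reflexive (∣∪⁅⁆∣ x∉A)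

two≤∣∣ : {A : Subset m} {x y : Fin m} → x ≢ y → x ∈ A → y ∈ A → 2 ≤ ∣ A ∣
two≤∣∣ x≢y x∈A y∈A = ≤-trans (≤-reflexive (sym (∣pair∣ x≢y))) (p⊆q⇒∣p∣≤∣q∣ (pair⊆ x∈A y∈A))

∣∣≤1⇒≡ : {A : Subset m} {x y : Fin m} → ∣ A ∣ ≤ 1 → x ∈ A → y ∈ A → x ≡ y
∣∣≤1⇒≡ {x = x} {y} ∣A∣≤1 x∈A y∈A with x Data.Fin.≟ y
... | yes x≡y = x≡y
... | no x≢y  = contradiction (≤-trans (two≤∣∣ x≢y x∈A y∈A) ∣A∣≤1) λ { (s≤s ()) }

0<∣∣⇒nonempty : (A : Subset m) → 0 < ∣ A ∣ → Nonempty A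
0<∣∣⇒nonempty {m} A 0<∣A∣ with nonempty? A
... | yes ne = ne
... | no ¬ne = contradiction (subst (0 <_) (trans (cong ∣_∣ (Empty-unique ¬ne)) (∣⊥∣≡0 m)) 0<∣A∣) λ ()

⊆-witness : (A B : Subset m) → A ⊆ B ⊎ ∃[ x ] x ∈ A × x ∉ B
⊆-witness A B with nonempty? (A ─ B)
... | yes (x , x∈) = inj₂ (x , p─q⊆p A B x∈ , ∈─⁻ {A = A} x∈)
... | no ¬ne = inj₁ λ {x} x∈A → case-∈ x∈A
  where
  case-∈ : ∀ {x} → x ∈ A → x ∈ B
  case-∈ {x} x∈A with x ∈? B
  ... | yes x∈B = x∈B
  ... | no x∉B  = contradiction (x , x∈p∧x∉q⇒x∈p─q x∈A x∉B) ¬ne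

∣∣<⇒witness : (A B : Subset m) → ∣ A ∣ < ∣ B ∣ → ∃[ x ] x ∈ B × x ∉ A
∣∣<⇒witness A B ∣A∣<∣B∣ with ⊆-witness B A
... | inj₂ witness = witness
... | inj₁ B⊆A     = contradiction (p⊆q⇒∣p∣≤∣q∣ B⊆A) (<⇒≱ ∣A∣<∣B∣)

-x∪x : {A : Subset m} {x : Fin m} → x ∈ A → (A - x) ∪ ⁅ x ⁆ ≡ A
-x∪x {A = A} {x} x∈A = ⊆-antisym (∪-elim (p─q⊆p A ⁅ x ⁆) (⁅⁆⊆ x∈A)) back
  where
  back : A ⊆ (A - x) ∪ ⁅ x ⁆
  back {y} y∈A with y Data.Fin.≟ x
  ... | yes refl = ∈∪₂ {A = A - x} (x∈⁅x⁆ x)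
  ... | no y≢x   = ∈∪₁ (x∈p∧x≢y⇒x∈p-y y∈A y≢x)

x∉-x : (A : Subset m) (x : Fin m) → x ∉ A - x
x∉-x A x x∈ = ∈─⁻ {A = A} x∈ (x∈⁅x⁆ x)

∣-x∣ : {A : Subset m} {x : Fin m} → x ∈ A → suc ∣ A - x ∣ ≡ ∣ A ∣
∣-x∣ {A = A} {x} x∈A = trans (sym (∣∪⁅⁆∣ (x∉-x A x))) (cong ∣_∣ (-x∪x x∈A))

subset-induction : (P : Subset m → Set) → P ⊥ → (∀ {A} x → x ∉ A → P A → P (A ∪ ⁅ x ⁆)) →
                   ∀ A → P A
subset-induction {m} P base step A = go ∣ A ∣ A refl
  where
  go : ∀ s A → ∣ A ∣ ≡ s → P A
  go zero A ∣A∣≡0 = subst P (sym (Empty-unique λ (x , x∈A) →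
    contradiction (p⊆q⇒∣p∣≤∣q∣ (⁅⁆⊆ x∈A))
      (<⇒≱ (subst₂ _<_ (sym ∣A∣≡0) (sym (∣⁅x⁆∣≡1 x)) (s≤s z≤n))))) base
  go (suc s) A ∣A∣≡ =
    let x , x∈A = 0<∣∣⇒nonempty A (subst (0 <_) (sym ∣A∣≡) (s≤s z≤n))
    in subst P (-x∪x x∈A) (step x (x∉-x A x) (go s (A - x) (suc-injective (trans (∣-x∣ x∈A) ∣A∣≡))))

intermediate : (B X : Subset m) (s : ℕ) → B ⊆ X → ∣ B ∣ ≤ s → s ≤ ∣ X ∣ →
               ∃[ A ] B ⊆ A × A ⊆ X × ∣ A ∣ ≡ s
intermediate {m} B X s B⊆X ∣B∣≤s s≤∣X∣ = go (s ∸ ∣ B ∣) B (λ x∈ → x∈) B⊆X (m∸n+n≡m ∣B∣≤s)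
  where
  go : ∀ r A → B ⊆ A → A ⊆ X → r + ∣ A ∣ ≡ s → ∃[ A ] B ⊆ A × A ⊆ X × ∣ A ∣ ≡ s
  go zero    A B⊆A A⊆X eq = A , B⊆A , A⊆X , eq
  go (suc r) A B⊆A A⊆X eq =
    let x , x∈X , x∉A = ∣∣<⇒witness A X (≤-trans (s≤s (m≤n+m ∣ A ∣ r)) (subst (_≤ ∣ X ∣) (sym eq) s≤∣X∣))
    in go r (A ∪ ⁅ x ⁆) (λ x∈ → ∈∪₁ (B⊆A x∈)) (∪-elim A⊆X (⁅⁆⊆ x∈X))
         (trans (cong (r +_) (∣∪⁅⁆∣ x∉A)) (trans (+-suc r ∣ A ∣) eq))

∣∩∣-monoˡ : {A B : Subset m} (X : Subset m) → A ⊆ B → ∣ A ∩ X ∣ ≤ ∣ B ∩ X ∣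
∣∩∣-monoˡ {A = A} X A⊆B = p⊆q⇒∣p∣≤∣q∣ λ x∈ → ∈∩ (A⊆B (∈∩₁ x∈)) (∈∩₂ {A = A} x∈)

∣⁅⁆∩∣-∈ : {X : Subset m} {e : Fin m} → e ∈ X → ∣ ⁅ e ⁆ ∩ X ∣ ≡ 1
∣⁅⁆∩∣-∈ {X = X} {e} e∈X = trans (cong ∣_∣ (⊆-antisym (p∩q⊆p ⁅ e ⁆ X) (⁅⁆⊆ (∈∩ (x∈⁅x⁆ e) e∈X)))) (∣⁅x⁆∣≡1 e)

∣⁅⁆∩∣-∉ : {X : Subset m} {e : Fin m} → e ∉ X → ∣ ⁅ e ⁆ ∩ X ∣ ≡ 0
∣⁅⁆∩∣-∉ {m} {X} {e} e∉X = trans (cong ∣_∣ (Empty-unique λ (y , y∈) →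
  e∉X (subst (_∈ X) (x∈⁅y⁆⇒x≡y e (∈∩₁ y∈)) (∈∩₂ {A = ⁅ e ⁆} y∈)))) (∣⊥∣≡0 m)

𝟙-∈ : (X : Subset m) (e : Fin m) → 𝟙 (e ∈? X) ≡ ∣ ⁅ e ⁆ ∩ X ∣
𝟙-∈ X e with e ∈? X
... | yes e∈X = sym (∣⁅⁆∩∣-∈ e∈X)
... | no e∉X  = sym (∣⁅⁆∩∣-∉ e∉X)

∣∣≡sum : (A : Subset m) → ∣ A ∣ ≡ sum (λ e → 𝟙 (e ∈? A))
∣∣≡sum []            = refl
∣∣≡sum (inside  ∷ A) = cong suc (∣∣≡sum A)
∣∣≡sum (outside ∷ A) = ∣∣≡sum A

-- Weights

weight : (Fin m → ℕ) → Subset m → ℕ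
weight v []            = 0
weight v (inside  ∷ A) = v zero + weight (v ∘ suc) A
weight v (outside ∷ A) = weight (v ∘ suc) A

private
  shuffle₁ : ∀ a {b c d e} → b + c ≡ d + e → a + b + c ≡ a + d + e
  shuffle₁ a {b} {c} {d} {e} eq = trans (+-assoc a b c) (trans (cong (a +_) eq) (sym (+-assoc a d e)))

  shuffle₂ : ∀ a {b c d e} → b + c ≡ d + e → a + b + c ≡ d + (a + e)
  shuffle₂ a {b} {c} {d} {e} eq = trans (shuffle₁ a eq) (lem a d e)
    where
    lem : ∀ a d e → a + d + e ≡ d + (a + e)
    lem = solve-∀

  shuffle₃ : ∀ a {b c d e} → b + c ≡ d + e → a + b + (a + c) ≡ a + d + (a + e)
  shuffle₃ a {b} {c} {d} {e} eq = trans (lem a b c) (trans (cong (λ z → a + a + z) eq) (sym (lem a d e)))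
    where
    lem : ∀ a d e → a + d + (a + e) ≡ a + a + (d + e)
    lem = solve-∀

weight-modular : (v : Fin m → ℕ) (A B : Subset m) →
                 weight v (A ∪ B) + weight v (A ∩ B) ≡ weight v A + weight v B
weight-modular v []            []            = refl
weight-modular v (inside  ∷ A) (inside  ∷ B) = shuffle₃ (v zero) (weight-modular (v ∘ suc) A B)
weight-modular v (inside  ∷ A) (outside ∷ B) = shuffle₁ (v zero) (weight-modular (v ∘ suc) A B)
weight-modular v (outside ∷ A) (inside  ∷ B) =
  shuffle₂ (v zero) {d = weight (v ∘ suc) A} (weight-modular (v ∘ suc) A B)
weight-modular v (outside ∷ A) (outside ∷ B) = weight-modular (v ∘ suc) A B

weight-⊥ : (v : Fin m → ℕ) → weight v ⊥ ≡ 0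
weight-⊥ {zero}  v = refl
weight-⊥ {suc m} v = weight-⊥ (v ∘ suc)

weight-⁅⁆ : (v : Fin m → ℕ) (e : Fin m) → weight v ⁅ e ⁆ ≡ v e
weight-⁅⁆ v zero    = trans (cong (v zero +_) (weight-⊥ (v ∘ suc))) (+-identityʳ _)
weight-⁅⁆ v (suc e) = weight-⁅⁆ (v ∘ suc) e

weight-cong : {u v : Fin m → ℕ} → u ≗ v → ∀ A → weight u A ≡ weight v A
weight-cong u≗v []            = refl
weight-cong u≗v (inside  ∷ A) = cong₂ _+_ (u≗v zero) (weight-cong (u≗v ∘ suc) A)
weight-cong u≗v (outside ∷ A) = weight-cong (u≗v ∘ suc) A

weight-mono : {u v : Fin m → ℕ} (A : Subset m) → (∀ {e} → e ∈ A → u e ≤ v e) →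
              weight u A ≤ weight v A
weight-mono []            u≤v = z≤n
weight-mono (inside  ∷ A) u≤v = +-mono-≤ (u≤v here) (weight-mono A (u≤v ∘ there))
weight-mono (outside ∷ A) u≤v = weight-mono A (u≤v ∘ there)

weight-const : (c : ℕ) (A : Subset m) → weight (const c) A ≡ ∣ A ∣ * c
weight-const c []            = refl
weight-const c (inside  ∷ A) = cong (c +_) (weight-const c A)
weight-const c (outside ∷ A) = weight-const c A

weight-sum : (v : Fin k → Fin m → ℕ) (A : Subset m) →
             sum (λ l → weight (v l) A) ≡ weight (λ e → sum (λ l → v l e)) A
weight-sum {zero}  v A = sym (trans (weight-const 0 A) (*-zeroʳ ∣ A ∣))
weight-sum {suc k} v A = trans (cong (weight (v zero) A +_) (weight-sum (v ∘ suc) A))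
                               (weight-+ (v zero) _ A)
  where
  weight-+ : ∀ {m} (u v : Fin m → ℕ) (A : Subset m) →
             weight u A + weight v A ≡ weight (λ e → u e + v e) A
  weight-+ u v []            = refl
  weight-+ u v (inside  ∷ A) =
    trans (lem (u zero) _ (v zero) _) (cong (u zero + v zero +_) (weight-+ (u ∘ suc) (v ∘ suc) A))
    where
    lem : ∀ a b c d → a + b + (c + d) ≡ a + c + (b + d)
    lem = solve-∀
  weight-+ u v (outside ∷ A) = weight-+ (u ∘ suc) (v ∘ suc) A

-- The indicator of `X` is written as `∣ ⁅ e ⁆ ∩ X ∣`, the form in which the rank equation returns
-- it on singletons.
weight-∩ : (A X : Subset m) → weight (λ e → ∣ ⁅ e ⁆ ∩ X ∣) A ≡ ∣ A ∩ X ∣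
weight-∩ []            []            = refl
weight-∩ {suc m} (inside ∷ A) (inside ∷ X) =
  cong suc (cong₂ _+_ (trans (cong ∣_∣ (∩-zeroˡ X)) (∣⊥∣≡0 m)) (weight-∩ A X))
weight-∩ {suc m} (inside ∷ A) (outside ∷ X) =
  cong₂ _+_ (trans (cong ∣_∣ (∩-zeroˡ X)) (∣⊥∣≡0 m)) (weight-∩ A X)
weight-∩ (outside ∷ A) (_ ∷ X) = weight-∩ A X

weight-disjoint : (v : Fin m → ℕ) (A : Subset m) {x : Fin m} → x ∉ A →
                  weight v (A ∪ ⁅ x ⁆) ≡ weight v A + v x
weight-disjoint v (inside  ∷ A) {zero}  x∉A = contradiction here x∉A
weight-disjoint v (outside ∷ A) {zero}  x∉A =
  trans (cong (λ B → v zero + weight (v ∘ suc) B) (∪-identityʳ A)) (+-comm (v zero) _)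
weight-disjoint v (inside  ∷ A) {suc x} x∉A =
  trans (cong (v zero +_) (weight-disjoint (v ∘ suc) A (x∉A ∘ there))) (sym (+-assoc (v zero) _ _))
weight-disjoint v (outside ∷ A) {suc x} x∉A = weight-disjoint (v ∘ suc) A (x∉A ∘ there)

∈-⋃ : (X : Fin n → Subset m) {i : Fin n} {is : List (Fin n)} → i Membership.∈ is →
      X i ⊆ ⋃ (List.map X is)
∈-⋃ X (Any.here refl) x∈ = ∈∪₁ x∈
∈-⋃ X {is = j ∷ _} (Any.there i∈) x∈ = ∈∪₂ {A = X j} (∈-⋃ X i∈ x∈)

-- d is the nullity function of N after its loops are turned into coloops, so that it vanishes on
-- singletons.
module Nullity (N : Matroid {m} ⊤) where
  r : Subset m → ℕ
  r = rank N

  v : Fin m → ℕ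
  v e = r ⁅ e ⁆

  s : Subset m → ℕ
  s = weight v

  d : Subset m → ℕ
  d A = s A ∸ r A

  v≤1 : ∀ e → v e ≤ 1
  v≤1 e = ≤-trans (Matroid.rank≤size N ⊆⊤) (≤-reflexive (∣⁅x⁆∣≡1 e))

  r-mono : ∀ {A B} → A ⊆ B → r A ≤ r B
  r-mono A⊆B = Matroid.nondecreasing N A⊆B ⊆⊤

  r-submodular : ∀ A B → r (A ∪ B) + r (A ∩ B) ≤ r A + r B
  r-submodular A B = Matroid.submodular N ⊆⊤ ⊆⊤

  r-subadditive : ∀ A B → r (A ∪ B) ≤ r A + r B
  r-subadditive A B = ≤-trans (m≤m+n _ _) (r-submodular A B)

  r-⊥ : r ⊥ ≡ 0
  r-⊥ = n≤0⇒n≡0 (≤-trans (Matroid.rank≤size N ⊆⊤) (≤-reflexive (∣⊥∣≡0 m)))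

  r≤s : ∀ A → r A ≤ s A
  r≤s = subset-induction _ (≤-trans (≤-reflexive r-⊥) z≤n) λ {A} x x∉A rA≤sA → begin
    r (A ∪ ⁅ x ⁆)  ≤⟨ r-subadditive A ⁅ x ⁆ ⟩
    r A + v x      ≤⟨ +-monoˡ-≤ (v x) rA≤sA ⟩
    s A + v x      ≡⟨ weight-disjoint v A x∉A ⟨
    s (A ∪ ⁅ x ⁆)  ∎
    where open ≤-Reasoning

  r+d≡s : ∀ A → r A + d A ≡ s A
  r+d≡s A = m+[n∸m]≡n (r≤s A)

  s≤size : ∀ A → s A ≤ ∣ A ∣
  s≤size A = ≤-trans (weight-mono A λ {e} _ → v≤1 e)
                     (≤-reflexive (trans (weight-const 1 A) (*-identityʳ ∣ A ∣)))

  d-⊥ : d ⊥ ≡ 0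
  d-⊥ = trans (cong (_∸ r ⊥) (weight-⊥ v)) (0∸n≡0 (r ⊥))

  d-⁅⁆ : ∀ e → d ⁅ e ⁆ ≡ 0
  d-⁅⁆ e = trans (cong (_∸ v e) (weight-⁅⁆ v e)) (n∸n≡0 (v e))

  -- `s` is modular, so submodularity of `r` turns into supermodularity of the difference.
  d-supermodular : ∀ A B → d A + d B ≤ d (A ∪ B) + d (A ∩ B)
  d-supermodular A B = linear 0 (r-submodular A B)
    (lem (r (A ∪ B)) (d (A ∪ B)) (r (A ∩ B)) (d (A ∩ B)) (r A) (d A) (r B) (d B) (begin
    r (A ∪ B) + d (A ∪ B) + (r (A ∩ B) + d (A ∩ B)) ≡⟨ cong₂ _+_ (r+d≡s (A ∪ B)) (r+d≡s (A ∩ B)) ⟩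
    s (A ∪ B) + s (A ∩ B)                           ≡⟨ weight-modular v A B ⟩
    s A + s B                                       ≡⟨ cong₂ _+_ (r+d≡s A) (r+d≡s B) ⟨
    r A + d A + (r B + d B)                         ∎))
    where
    open ≡-Reasoning
    lem : ∀ a b c e a′ b′ c′ e′ → a + b + (c + e) ≡ a′ + b′ + (c′ + e′) →
          b′ + e′ + (a′ + c′) + 0 ≡ b + e + (a + c)
    lem a b c e a′ b′ c′ e′ eq =
      trans (+-identityʳ _) (trans (reorder b′ e′ a′ c′) (trans (sym eq) (sym (reorder b e a c))))
      where
      reorder : ∀ b e a c → b + e + (a + c) ≡ a + b + (c + e)
      reorder = solve-∀

  d-mono : ∀ {A B} → A ⊆ B → d A ≤ d B
  d-mono {A} {B} A⊆B = begin
    d A                                ≤⟨ m≤m+n (d A) (d (B ─ A)) ⟩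
    d A + d (B ─ A)                    ≤⟨ d-supermodular A (B ─ A) ⟩
    d (A ∪ (B ─ A)) + d (A ∩ (B ─ A))  ≡⟨ cong₂ _+_ (cong d union) (trans (cong d disjoint) d-⊥) ⟩
    d B + 0                            ≡⟨ +-identityʳ (d B) ⟩
    d B                                ∎
    where
    open ≤-Reasoning
    disjoint : A ∩ (B ─ A) ≡ ⊥
    disjoint = Empty-unique λ (x , x∈) → ∈─⁻ {A = B} (∈∩₂ {A = A} x∈) (∈∩₁ x∈)
    back : B ⊆ A ∪ (B ─ A)
    back {x} x∈B with x ∈? A
    ... | yes x∈A = ∈∪₁ x∈A
    ... | no x∉A  = ∈∪₂ {A = A} (x∈p∧x∉q⇒x∈p─q x∈B x∉A)
    union : A ∪ (B ─ A) ≡ B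
    union = ⊆-antisym (∪-elim A⊆B (p─q⊆p B A)) back

  -- Takes the place of circuit elimination: two sets of positive nullity with independent
  -- intersection force nullity 2 on any set containing both.
  d-super : ∀ {A B S} → A ∪ B ⊆ S → d A + d B ≤ d S + d (A ∩ B)
  d-super {A} {B} A∪B⊆S = ≤-trans (d-supermodular A B) (+-monoˡ-≤ _ (d-mono A∪B⊆S))

  -- `r` cannot drop, so `d` grows by at most the growth `v x` of `s`. In particular a loop never
  -- changes `d`.
  d-∪⁅⁆ : ∀ A x → d (A ∪ ⁅ x ⁆) ≤ d A + v x
  d-∪⁅⁆ A x with x ∈? A
  ... | yes x∈A = ≤-trans (≤-reflexive (cong d (∪⁅⁆-absorb x∈A))) (m≤m+n (d A) (v x))
  ... | no x∉A  = linear 0 (r-mono (∈∪₁ {A = A} {⁅ x ⁆})) (begin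
    d (A ∪ ⁅ x ⁆) + r (A ∪ ⁅ x ⁆) + 0  ≡⟨ lem₁ _ (r (A ∪ ⁅ x ⁆)) ⟩
    r (A ∪ ⁅ x ⁆) + d (A ∪ ⁅ x ⁆)      ≡⟨ r+d≡s (A ∪ ⁅ x ⁆) ⟩
    s (A ∪ ⁅ x ⁆)                      ≡⟨ weight-disjoint v A x∉A ⟩
    s A + v x                          ≡⟨ cong (_+ v x) (r+d≡s A) ⟨
    r A + d A + v x                    ≡⟨ lem₂ (r A) (d A) (v x) ⟩
    d A + v x + r A                    ∎)
    where
    open ≡-Reasoning
    lem₁ : ∀ a b → a + b + 0 ≡ b + a
    lem₁ = solve-∀
    lem₂ : ∀ a b c → a + b + c ≡ b + c + a
    lem₂ = solve-∀

  d-step : ∀ A x → d (A ∪ ⁅ x ⁆) ≤ suc (d A)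
  d-step A x = ≤-trans (d-∪⁅⁆ A x) (≤-trans (+-monoʳ-≤ (d A) (v≤1 x)) (≤-reflexive (+-comm (d A) 1)))

  d-remove : ∀ {A x} → x ∈ A → d A ≤ d (A - x) + v x
  d-remove {A} {x} x∈A = subst (λ B → d B ≤ d (A - x) + v x) (-x∪x x∈A) (d-∪⁅⁆ (A - x) x)

  -- Equivalently, `∣ A ∣ - d A` is monotone: it is the rank after loops are made coloops. The
  -- induction adds the elements of `B` to `A`, each raising `d` by at most 1.
  d-lipschitz : ∀ {A B} → A ⊆ B → d B + ∣ A ∣ ≤ d A + ∣ B ∣
  d-lipschitz {A} {B} A⊆B = subst (λ S → d S + ∣ A ∣ ≤ d A + ∣ S ∣) union
    (subset-induction (λ F → d (A ∪ F) + ∣ A ∣ ≤ d A + ∣ A ∪ F ∣) base step B)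
    where
    union : A ∪ B ≡ B
    union = ⊆-antisym (∪-elim A⊆B (λ x∈ → x∈)) (∈∪₂ {A = A})
    base : d (A ∪ ⊥) + ∣ A ∣ ≤ d A + ∣ A ∪ ⊥ ∣
    base = ≤-reflexive (cong₂ _+_ (cong d (∪-identityʳ A)) (sym (cong ∣_∣ (∪-identityʳ A))))
    step : ∀ {F} x → x ∉ F → d (A ∪ F) + ∣ A ∣ ≤ d A + ∣ A ∪ F ∣ →
           d (A ∪ (F ∪ ⁅ x ⁆)) + ∣ A ∣ ≤ d A + ∣ A ∪ (F ∪ ⁅ x ⁆) ∣
    step {F} x _ hyp rewrite sym (∪-assoc A F ⁅ x ⁆) with x ∈? A ∪ F
    ... | yes x∈ rewrite ∪⁅⁆-absorb x∈ = hyp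
    ... | no x∉  rewrite ∣∪⁅⁆∣ x∉ | +-suc (d A) ∣ A ∪ F ∣ =
      ≤-trans (+-monoˡ-≤ ∣ A ∣ (d-step (A ∪ F) x)) (s≤s hyp)

  -- Build up `A` one element at a time and stop where the nullity first becomes positive.
  d-jump : ∀ A → 0 < d A → ∃[ B ] ∃[ x ] B ∪ ⁅ x ⁆ ⊆ A × x ∉ B × d B ≡ 0 × 0 < d (B ∪ ⁅ x ⁆)
  d-jump = subset-induction _ (λ 0<d → contradiction (subst (0 <_) d-⊥ 0<d) λ ()) step
    where
    P : Subset m → Set
    P A = 0 < d A → ∃[ B ] ∃[ x ] B ∪ ⁅ x ⁆ ⊆ A × x ∉ B × d B ≡ 0 × 0 < d (B ∪ ⁅ x ⁆)
    step : ∀ {A} x → x ∉ A → P A → P (A ∪ ⁅ x ⁆)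
    step {A} x x∉A ih 0<d with d A in eq
    ... | zero  = A , x , (λ x∈ → x∈) , x∉A , eq , 0<d
    ... | suc _ =
      let B , y , B⊆ , rest = ih (s≤s z≤n)
      in B , y , (λ z∈ → ∈∪₁ (B⊆ z∈)) , rest

  -- Both elements are then non-loops, since adding a loop leaves `d` unchanged and `d` vanishes on
  -- singletons.
  Parallel : Fin m → Fin m → Set
  Parallel x y = 0 < d (⁅ x ⁆ ∪ ⁅ y ⁆)

  parallel-sym : ∀ {x y} → Parallel x y → Parallel y x
  parallel-sym {x} {y} = subst (λ A → 0 < d A) (∪-comm ⁅ x ⁆ ⁅ y ⁆)

  d-∩⁅⁆ : ∀ {A B x} → (∀ {y} → y ∈ A → y ∈ B → y ≡ x) → d (A ∩ B) ≡ 0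
  d-∩⁅⁆ {A} {B} {x} eq = n≤0⇒n≡0 (≤-trans
    (d-mono {A ∩ B} {⁅ x ⁆} λ y∈ → subst (_∈ ⁅ x ⁆) (sym (eq (∈∩₁ y∈) (∈∩₂ {A = A} y∈))) (x∈⁅x⁆ x))
    (≤-reflexive (d-⁅⁆ x)))

  -- The intersection lies in a singleton, so it has nullity 0 and the two nullities add.
  d-glue : ∀ {A B S x} → A ∪ B ⊆ S → (∀ {y} → y ∈ A → y ∈ B → y ≡ x) → d A + d B ≤ d S
  d-glue {A} {B} {S} A∪B⊆S eq = ≤-trans (d-super A∪B⊆S)
    (≤-reflexive (trans (cong (d S +_) (d-∩⁅⁆ eq)) (+-identityʳ (d S))))

  parallel-glue : ∀ {x y z S} → Parallel x y → Parallel x z → y ≢ z →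
                  x ∈ S → y ∈ S → z ∈ S → 2 ≤ d S
  parallel-glue {x} {y} {z} xy xz y≢z x∈S y∈S z∈S =
    ≤-trans (+-mono-≤ xy xz) (d-glue (∪-elim (pair⊆ x∈S y∈S) (pair⊆ x∈S z∈S)) common)
    where
    common : ∀ {u} → u ∈ ⁅ x ⁆ ∪ ⁅ y ⁆ → u ∈ ⁅ x ⁆ ∪ ⁅ z ⁆ → u ≡ x
    common u∈ u∈′ with ∈pair⁻ u∈ | ∈pair⁻ u∈′
    ... | inj₁ u≡x | _        = u≡x
    ... | inj₂ _   | inj₁ u≡x = u≡x
    ... | inj₂ u≡y | inj₂ u≡z = contradiction (trans (sym u≡y) u≡z) y≢z

  -- Gluing the two pairs at y gives the triple nullity 2, and removing y costs at most 1.
  parallel-trans : ∀ {x y z} → Parallel x y → Parallel y z → x ≢ z → Parallel x z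
  parallel-trans {x} {y} {z} xy yz x≢z = s≤s⁻¹ (≤-trans
    (parallel-glue {S = ⁅ x ⁆ ∪ ⁅ z ⁆ ∪ ⁅ y ⁆} (parallel-sym xy) yz x≢z
      (∈∪₂ {A = ⁅ x ⁆} (∈₂ {x = z})) (∈∪₁ (x∈⁅x⁆ x)) (∈∪₂ {A = ⁅ x ⁆} ∈₁))
    (subst (λ A → d A ≤ suc (d (⁅ x ⁆ ∪ ⁅ z ⁆))) (∪-assoc ⁅ x ⁆ ⁅ z ⁆ ⁅ y ⁆)
      (d-step (⁅ x ⁆ ∪ ⁅ z ⁆) y)))

-- Decompositions that agree with `ρ` on the prescribed sets

module Decomposition {m n k : ℕ} (H : Hypergraph m n) (t : Fin n → ℕ)
  (h2 : H2 H) (h3 : H3 H) (condT : CondT H t) (N : Fin k → Matroid {m} ⊤)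
  -- This stands in for σ, so that the same argument serves decompositions of σ and of `ρ`.
  (rank-sum : ∀ A → Prescribed H t A →
              sum (λ l → rank (N l) A) ≡ sum (λ i → ∣ A ∩ X H i ∣ ⊓ t i)) where
  open Hypergraph H using (X-nonempty; X-injective)

  E : Fin n → Subset m
  E = X H

  module _ (l : Fin k) where
    open Nullity (N l) public

  -- The nullity of `A ∩ E h` in the uniform matroid of rank `t h`.
  excess : Fin n → Subset m → ℕ
  excess h A = ∣ A ∩ E h ∣ ∸ t h

  w≡sum : ∀ e → w H e ≡ sum (λ i → ∣ ⁅ e ⁆ ∩ E i ∣)
  w≡sum e = trans (length≡∑ (filter (λ i → e ∈? E i) (allFin n)))
    (trans (∑-filter (λ i → e ∈? E i) (const 1)) (sum-cong-≗ λ i → 𝟙-∈ (E i) e))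

  minDegree-attained : ∀ i → ∃[ e ] e ∈ E i × w H e ≤ minDegree H i
  minDegree-attained i
    with Extrema.argmin-sel id n (List.map (w H) (filter (_∈? E i) (allFin m)))
  -- The default `n` bounds every degree, so any element of the edge will do.
  ... | inj₁ min≡n =
    let e , e∈ = X-nonempty i
    in e , e∈ , subst (w H e ≤_) (sym min≡n)
         (≤-trans (length-filter (λ j → e ∈? E j) (allFin n)) (≤-reflexive (length-tabulate {n = n} id)))
  ... | inj₂ min∈ =
    let e , e∈filter , min≡ = ∈-map⁻ (w H) min∈
    in e , proj₂ (∈-filter⁻ (_∈? E i) {xs = allFin m} e∈filter) , ≤-reflexive (sym min≡)

  -- An element of `E i` has degree at least 1, so the lower bound in (T) is positive.
  t-positive : ∀ i → 0 < t i
  t-positive i with condT i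
  ... | inj₁ t≡1         = ≤-reflexive (sym t≡1)
  ... | inj₂ (min≤t , _) =
    let e , e∈ , w≤min = minDegree-attained i
    in begin
         1                            ≡⟨ ∣⁅⁆∩∣-∈ e∈ ⟨
         ∣ ⁅ e ⁆ ∩ E i ∣              ≤⟨ term≤sum (λ j → ∣ ⁅ e ⁆ ∩ E j ∣) i ⟩
         sum (λ j → ∣ ⁅ e ⁆ ∩ E j ∣)  ≡⟨ w≡sum e ⟨
         w H e                        ≤⟨ w≤min ⟩
         minDegree H i                ≤⟨ min≤t ⟩
         t i                          ∎
    where open ≤-Reasoning

  -- Singletons fall under (a), and `t-positive` removes the truncation. Since `v l e ≤ 1`, e is a
  -- non-loop in exactly `w H e` of the matroids.
  v-sum : ∀ e → sum (λ l → v l e) ≡ sum (λ i → ∣ ⁅ e ⁆ ∩ E i ∣)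
  v-sum e = trans (rank-sum ⁅ e ⁆ (size≤3 (≤-trans (≤-reflexive (∣⁅x⁆∣≡1 e)) (s≤s z≤n))))
    (sum-cong-≗ λ i → m≤n⇒m⊓n≡m (≤-trans (∣p∩q∣≤∣p∣ ⁅ e ⁆ (E i))
      (≤-trans (≤-reflexive (∣⁅x⁆∣≡1 e)) (t-positive i))))

  s-sum : ∀ A → sum (λ l → s l A) ≡ sum (λ i → ∣ A ∩ E i ∣)
  s-sum A = begin
    sum (λ l → weight (v l) A)                          ≡⟨ weight-sum v A ⟩
    weight (λ e → sum (λ l → v l e)) A                  ≡⟨ weight-cong v-sum A ⟩
    weight (λ e → sum (λ i → ∣ ⁅ e ⁆ ∩ E i ∣)) A        ≡⟨ weight-sum (λ i e → ∣ ⁅ e ⁆ ∩ E i ∣) A ⟨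
    sum (λ i → weight (λ e → ∣ ⁅ e ⁆ ∩ E i ∣) A)        ≡⟨ sum-cong-≗ (λ i → weight-∩ A (E i)) ⟩
    sum (λ i → ∣ A ∩ E i ∣)                             ∎
    where open ≡-Reasoning

  nullity-sum : ∀ {A} → Prescribed H t A → sum (λ l → d l A) ≡ sum (λ h → excess h A)
  nullity-sum {A} pre = +-cancelˡ-≡ (sum (λ l → r l A)) _ _ (begin
    sum (λ l → r l A) + sum (λ l → d l A)              ≡⟨ ∑-distrib-+ (λ l → r l A) (λ l → d l A) ⟨
    sum (λ l → r l A + d l A)                          ≡⟨ sum-cong-≗ (λ l → r+d≡s l A) ⟩
    sum (λ l → s l A)                                  ≡⟨ s-sum A ⟩
    sum (λ i → ∣ A ∩ E i ∣)                            ≡⟨ sum-cong-≗ split ⟨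
    sum (λ i → ∣ A ∩ E i ∣ ⊓ t i + excess i A)         ≡⟨ ∑-distrib-+ (λ i → ∣ A ∩ E i ∣ ⊓ t i) (λ i → excess i A) ⟩
    sum (λ i → ∣ A ∩ E i ∣ ⊓ t i) + sum (λ i → excess i A)
                                                       ≡⟨ cong (_+ sum (λ i → excess i A)) (rank-sum A pre) ⟨
    sum (λ l → r l A) + sum (λ i → excess i A)         ∎)
    where
    open ≡-Reasoning
    split : ∀ i → ∣ A ∩ E i ∣ ⊓ t i + excess i A ≡ ∣ A ∩ E i ∣
    split i = trans (cong (_+ excess i A) (⊓-comm ∣ A ∩ E i ∣ (t i))) (m⊓n+n∸m≡n (t i) ∣ A ∩ E i ∣)

  same-edge : ∀ {h i x y} → x ≢ y → x ∈ E h → y ∈ E h → x ∈ E i → y ∈ E i → h ≡ i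
  same-edge {h} {i} x≢y xh yh xi yi with h Fin.≟ i
  ... | yes h≡i = h≡i
  ... | no h≢i  = contradiction (two≤∣∣ x≢y (∈∩ xh xi) (∈∩ yh yi)) (<⇒≱ (s≤s (h2 h i h≢i)))

  meet≤1 : ∀ {A h i} → h ≢ i → A ⊆ E i → ∣ A ∩ E h ∣ ≤ 1
  meet≤1 {A} {h} {i} h≢i A⊆Ei =
    ≤-trans (p⊆q⇒∣p∣≤∣q∣ λ x∈ → ∈∩ (∈∩₂ {A = A} x∈) (A⊆Ei (∈∩₁ x∈))) (h2 h i h≢i)

  excess-edge : ∀ {A} i → A ⊆ E i → sum (λ h → excess h A) ≡ ∣ A ∣ ∸ t i
  excess-edge {A} i A⊆Ei = trans
    (sum-single (λ h → excess h A) i λ h h≢i → m≤n⇒m∸n≡0 (≤-trans (meet≤1 h≢i A⊆Ei) (t-positive h)))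
    (cong (λ B → ∣ B ∣ ∸ t i) (⊆-antisym (p∩q⊆p A (E i)) λ x∈A → ∈∩ x∈A (A⊆Ei x∈A)))

  edge-sum : ∀ {A} i → A ⊆ E i → ∣ A ∣ ≤ suc (t i) → sum (λ l → d l A) ≡ ∣ A ∣ ∸ t i
  edge-sum i A⊆Ei ∣A∣≤ = trans
    (nullity-sum (inEdge i A⊆Ei (≤-trans ∣A∣≤ (≤-reflexive (+-comm 1 (t i)))))) (excess-edge i A⊆Ei)

  edge-circuit : ∀ {A} i → A ⊆ E i → ∣ A ∣ ≡ suc (t i) → sum (λ l → d l A) ≡ 1
  edge-circuit i A⊆Ei ∣A∣≡ = trans (edge-sum i A⊆Ei (≤-reflexive ∣A∣≡))
    (trans (cong (_∸ t i) ∣A∣≡) (m+n∸n≡m 1 (t i)))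

  edge-independent : ∀ {A} i l → A ⊆ E i → ∣ A ∣ ≤ t i → d l A ≡ 0
  edge-independent {A} i l A⊆Ei ∣A∣≤t = n≤0⇒n≡0 (≤-trans (term≤sum (λ l → d l A) l)
    (≤-reflexive (trans (edge-sum i A⊆Ei (m≤n⇒m≤1+n ∣A∣≤t)) (m≤n⇒m∸n≡0 ∣A∣≤t))))

  -- The colour of a big edge

  unique-colour : ∀ {A l l′} → sum (λ l → d l A) ≡ 1 → 0 < d l A → 0 < d l′ A → l ≡ l′
  unique-colour {A} {l} {l′} ∑d≡1 0<d 0<d′ with l Fin.≟ l′
  ... | yes l≡l′ = l≡l′
  ... | no l≢l′  = contradiction (begin
    2                          ≤⟨ +-mono-≤ 0<d (+-monoˡ-≤ 0 0<d′) ⟩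
    d l A + (d l′ A + 0)       ≤⟨ sum-unique (λ l → d l A) ((l≢l′ ∷ []) ∷ [] ∷ []) ⟩
    sum (λ l → d l A)          ≡⟨ ∑d≡1 ⟩
    1                          ∎) λ { (s≤s ()) }
    where open ≤-Reasoning

  -- By (T) the only edges that fail this are singletons with `t i ≡ 1`. They contain no circuit
  -- that could fix a colour and are treated separately.
  Big : Fin n → Set
  Big i = t i < ∣ E i ∣

  -- N l restricted to E i is the uniform matroid of rank t i.
  Good : Fin k → Fin n → Set
  Good l i = ∣ E i ∣ ≤ d l (E i) + t i

  good-⊆ : ∀ {l i A} → Good l i → A ⊆ E i → ∣ A ∣ ≤ d l A + t i
  good-⊆ {l} {i} {A} good A⊆Ei = linear 0 (+-mono-≤ (d-lipschitz l A⊆Ei) good)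
    (lem (∣ A ∣) (d l A) (∣ E i ∣) (d l (E i)) (t i))
    where
    lem : ∀ a da e de u → a + (da + e + (de + u)) + 0 ≡ da + u + (de + a + e)
    lem = solve-∀

  good-circuit : ∀ {l i A} → Good l i → A ⊆ E i → ∣ A ∣ ≡ suc (t i) → 0 < d l A
  good-circuit {l} {i} {A} good A⊆Ei ∣A∣≡ =
    +-cancelʳ-≤ (t i) 1 (d l A) (subst (_≤ d l A + t i) ∣A∣≡ (good-⊆ good A⊆Ei))

  big-circuit : ∀ {i} → Big i → ∃[ A ] A ⊆ E i × ∣ A ∣ ≡ suc (t i)
  big-circuit {i} big =
    let A , _ , A⊆Ei , ∣A∣≡ = intermediate ⊥ (E i) (suc (t i)) ⊥⊆
                                 (≤-trans (≤-reflexive (∣⊥∣≡0 m)) z≤n) big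
    in A , A⊆Ei , ∣A∣≡

  good-unique : ∀ {l l′ i} → Big i → Good l i → Good l′ i → l ≡ l′
  good-unique {i = i} big good good′ =
    let A , A⊆Ei , ∣A∣≡ = big-circuit big
    in unique-colour (edge-circuit i A⊆Ei ∣A∣≡)
         (good-circuit good A⊆Ei ∣A∣≡) (good-circuit good′ A⊆Ei ∣A∣≡)

  -- Pigeonhole: two of the circuits S - g have the same colour, so their union has nullity 2.
  pigeonhole : ∀ {S Q i} (b : Fin k → ℕ) → S ⊆ E i → ∣ S ∣ ≡ 2 + t i → Q ⊆ S →
               (∀ l {g} → g ∈ Q → d l (S - g) ≤ b l) → sum b < ∣ Q ∣ → ∃[ l ] 2 ≤ d l S
  pigeonhole {S} {Q} {i} b S⊆Ei ∣S∣≡ Q⊆S d≤b ∑b<∣Q∣ =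
    let l , g , g′ , g≢g′ , 0<F , 0<F′ = collision F b F≤b
          (subst (sum b <_) (trans (∣∣≡sum Q) (sum-cong-≗ F-sum)) ∑b<∣Q∣)
        g∈Q  , 0<d  = F-pos l g 0<F
        g′∈Q , 0<d′ = F-pos l g′ 0<F′
    in l , ≤-trans (+-mono-≤ 0<d 0<d′) (≤-trans
         (d-super l {S = S} (∪-elim {A = S - g} {S - g′} (p─q⊆p S _) (p─q⊆p S _)))
         (≤-reflexive (trans (cong (d l S +_) (meet l (Q⊆S g∈Q) (Q⊆S g′∈Q) g≢g′)) (+-identityʳ _))))
    where
    -- For `g ∈ Q` the set `S - g` is a `(t i + 1)`-subset of `E i`, so its column adds up to 1 and
    -- the whole table to `∣ Q ∣`.
    F : Fin k → Fin m → ℕ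
    F l g = if does (g ∈? Q) then d l (S - g) else 0
    size : ∀ {g} → g ∈ S → ∣ S - g ∣ ≡ suc (t i)
    size g∈S = suc-injective (trans (∣-x∣ g∈S) ∣S∣≡)
    F≤b : ∀ l g → F l g ≤ b l
    F≤b l g with g ∈? Q
    ... | yes g∈Q = d≤b l g∈Q
    ... | no _    = z≤n
    F-pos : ∀ l g → 0 < F l g → g ∈ Q × 0 < d l (S - g)
    F-pos l g 0<F with g ∈? Q
    ... | yes g∈Q = g∈Q , 0<F
    F-sum : ∀ g → 𝟙 (g ∈? Q) ≡ sum (λ l → F l g)
    F-sum g with g ∈? Q
    ... | yes g∈Q = sym (edge-circuit i (λ x∈ → S⊆Ei (p─q⊆p S _ x∈)) (size (Q⊆S g∈Q)))
    ... | no _    = sym (sum-replicate-zero k)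
    -- Without g and g′ only `t i` elements of `S` remain, and these are independent in every
    -- colour.
    meet : ∀ l {g g′} → g ∈ S → g′ ∈ S → g ≢ g′ → d l ((S - g) ∩ (S - g′)) ≡ 0
    meet l {g} {g′} g∈S g′∈S g≢g′ = edge-independent i l (λ x∈ → S⊆Ei (p─q⊆p S _ (∈∩₁ x∈)))
      (s≤s⁻¹ (≤-trans (≤-reflexive (sym (∣∪⁅⁆∣ g′∉)))
        (≤-trans (p⊆q⇒∣p∣≤∣q∣ (∪-elim ∈∩₁ (⁅⁆⊆ (x∈p∧x≢y⇒x∈p-y g′∈S (g≢g′ ∘ sym)))))
          (≤-reflexive (size g∈S)))))
      where
      g′∉ : g′ ∉ (S - g) ∩ (S - g′)
      g′∉ g′∈ = x∉-x S g′ (∈∩₂ {A = S - g} g′∈)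

  private
    -- `A ∪ F` and `A ∪ ⁅ x ⁆` meet inside `A`, of nullity 1, while `A ∪ ⁅ x ⁆` has nullity 2. By
    -- supermodularity every new x therefore raises the nullity by one.
    good-grow′ : ∀ {A i} l → A ⊆ E i → ∣ A ∣ ≡ suc (t i) → d l A ≡ 1 →
                 (∀ {x} → x ∈ E i → x ∉ A → 2 ≤ d l (A ∪ ⁅ x ⁆)) → Good l i
    good-grow′ {A} {i} l A⊆Ei ∣A∣≡ dA≡1 swap = subst (λ S → ∣ S ∣ ≤ d l S + t i)
      (⊆-antisym (∪-elim A⊆Ei id) (∈∪₂ {A = A})) (subset-induction P base step (E i) id)
      where
      P : Subset m → Set
      P F = F ⊆ E i → ∣ A ∪ F ∣ ≤ d l (A ∪ F) + t i
      base : P ⊥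
      base _ = subst (λ S → ∣ S ∣ ≤ d l S + t i) (sym (∪-identityʳ A))
        (≤-reflexive (trans ∣A∣≡ (cong (_+ t i) (sym dA≡1))))
      step : ∀ {F} x → x ∉ F → P F → P (F ∪ ⁅ x ⁆)
      step {F} x x∉F ih Fx⊆Ei rewrite sym (∪-assoc A F ⁅ x ⁆) with x ∈? A ∪ F
      ... | yes x∈ rewrite ∪⁅⁆-absorb x∈ = ih (Fx⊆Ei ∘ ∈∪₁)
      ... | no x∉ rewrite ∣∪⁅⁆∣ x∉ = begin
        suc ∣ A ∪ F ∣               ≤⟨ s≤s (ih (Fx⊆Ei ∘ ∈∪₁)) ⟩
        suc (d l (A ∪ F)) + t i     ≤⟨ +-monoˡ-≤ (t i) d-increases ⟩
        d l ((A ∪ F) ∪ ⁅ x ⁆) + t i ∎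
        where
        open ≤-Reasoning
        meet : (A ∪ F) ∩ (A ∪ ⁅ x ⁆) ⊆ A
        meet y∈ with x∈p∪q⁻ A ⁅ x ⁆ (∈∩₂ {A = A ∪ F} y∈)
        ... | inj₁ y∈A = y∈A
        ... | inj₂ y∈x = contradiction (subst (_∈ A ∪ F) (x∈⁅y⁆⇒x≡y x y∈x) (∈∩₁ y∈)) x∉
        lem : ∀ a b c e → suc a + (c + e + b + 1) + 0 ≡ c + (a + b + 2 + e)
        lem = solve-∀
        d-increases : suc (d l (A ∪ F)) ≤ d l ((A ∪ F) ∪ ⁅ x ⁆)
        d-increases = linear 0
          (+-mono-≤ (+-mono-≤ (d-super l {A ∪ F} {A ∪ ⁅ x ⁆} {(A ∪ F) ∪ ⁅ x ⁆}
                                (∪-elim ∈∪₁ (∪-elim (∈∪₁ ∘ ∈∪₁) (∈∪₂ {A = A ∪ F}))))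
                              (swap (Fx⊆Ei (∈∪₂ {A = F} (x∈⁅x⁆ x))) (x∉ ∘ ∈∪₁)))
                    (≤-trans (d-mono l meet) (≤-reflexive dA≡1)))
          (lem (d l (A ∪ F)) (d l (A ∪ ⁅ x ⁆)) (d l ((A ∪ F) ∪ ⁅ x ⁆)) (d l ((A ∪ F) ∩ (A ∪ ⁅ x ⁆))))

  -- The colour supplied may depend on x, but nullity 2 on `A ∪ ⁅ x ⁆` leaves at least 1 on `A`, and
  -- only one colour has that.
  good-grow : ∀ {A i} → A ⊆ E i → ∣ A ∣ ≡ suc (t i) →
              (∀ {x} → x ∈ E i → x ∉ A → ∃[ l ] 2 ≤ d l (A ∪ ⁅ x ⁆)) → ∃[ l ] Good l i
  good-grow {A} {i} A⊆Ei ∣A∣≡ swap = l₀ , good-grow′ l₀ A⊆Ei ∣A∣≡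
    (≤-antisym (≤-trans (term≤sum (λ l → d l A) l₀) (≤-reflexive ∑d≡1)) (proj₂ first)) λ {x} x∈Ei x∉A →
      let l , 2≤d = swap x∈Ei x∉A
      in subst (λ l → 2 ≤ d l (A ∪ ⁅ x ⁆))
           (unique-colour ∑d≡1 (s≤s⁻¹ (≤-trans 2≤d (d-step l A x))) (proj₂ first)) 2≤d
    where
    ∑d≡1 : sum (λ l → d l A) ≡ 1
    ∑d≡1 = edge-circuit i A⊆Ei ∣A∣≡
    first : ∃[ l ] 0 < d l A
    first = sum-pos (λ l → d l A) (≤-reflexive (sym ∑d≡1))
    l₀ : Fin k
    l₀ = proj₁ first

  abstract
    -- Both cases apply `pigeonhole` to `S = A ∪ ⁅ x ⁆`, of size `t i + 2`. If `t i ≡ 1`, then (a)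
    -- gives `S` total nullity 2, against three choices of g. Otherwise `A` is chosen through an
    -- element e with `w H e ≤ t i`. As `S - g - e` is independent, colour l has nullity at most
    -- `v l e` on `S - g`; these bounds add up to `w H e`, against `t i + 1` choices of g other than
    -- e.
    good-exists : ∀ {i} → Big i → ∃[ l ] Good l i
    good-exists {i} big with condT i
    ... | inj₁ t≡1 =
      let A , A⊆Ei , ∣A∣≡ = big-circuit big
      in good-grow A⊆Ei ∣A∣≡ λ {x} x∈Ei x∉A →
        let S = A ∪ ⁅ x ⁆
            S⊆Ei : S ⊆ E i
            S⊆Ei = ∪-elim A⊆Ei (⁅⁆⊆ x∈Ei)
            ∣S∣≡ = trans (∣∪⁅⁆∣ x∉A) (cong suc ∣A∣≡)
            ∣S∣≡3 = trans ∣S∣≡ (cong (2 +_) t≡1)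
            ∑d≡2 = trans (nullity-sum (size≤3 (≤-reflexive ∣S∣≡3)))
                     (trans (excess-edge i S⊆Ei) (cong₂ _∸_ ∣S∣≡3 t≡1))
        in pigeonhole (λ l → d l S) S⊆Ei ∣S∣≡ id (λ l _ → d-mono l (p─q⊆p S _))
             (subst₂ _<_ (sym ∑d≡2) (sym ∣S∣≡3) ≤-refl)
    ... | inj₂ (min≤t , _) =
      let e , e∈Ei , w≤min = minDegree-attained i
          A , e⊆A , A⊆Ei , ∣A∣≡ = intermediate ⁅ e ⁆ (E i) (suc (t i)) (⁅⁆⊆ e∈Ei)
                                     (≤-trans (≤-reflexive (∣⁅x⁆∣≡1 e)) (s≤s z≤n)) big
          e∈A = e⊆A (x∈⁅x⁆ e)
      in good-grow A⊆Ei ∣A∣≡ λ {x} x∈Ei x∉A →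
        let S = A ∪ ⁅ x ⁆
            S⊆Ei : S ⊆ E i
            S⊆Ei = ∪-elim A⊆Ei (⁅⁆⊆ x∈Ei)
            ∣S∣≡ = trans (∣∪⁅⁆∣ x∉A) (cong suc ∣A∣≡)
            e∈S = ∈∪₁ e∈A
            ∑v≤t = ≤-trans (≤-reflexive (trans (v-sum e) (sym (w≡sum e)))) (≤-trans w≤min min≤t)
        in pigeonhole (λ l → v l e) S⊆Ei ∣S∣≡ (p─q⊆p S ⁅ e ⁆) (bound e S⊆Ei ∣S∣≡ e∈S)
             (subst (sum (λ l → v l e) <_) (sym (suc-injective (trans (∣-x∣ e∈S) ∣S∣≡))) (s≤s ∑v≤t))
      where
      bound : ∀ {S} e → S ⊆ E i → ∣ S ∣ ≡ 2 + t i → e ∈ S → ∀ l {g} → g ∈ S - e → d l (S - g) ≤ v l e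
      bound {S} e S⊆Ei ∣S∣≡ e∈S l {g} g∈S-e = ≤-trans (d-remove l e∈S-g)
        (≤-reflexive (cong (_+ v l e) (edge-independent i l
          (λ y∈ → S⊆Ei (p─q⊆p S _ (p─q⊆p (S - g) _ y∈)))
          (≤-reflexive (suc-injective (suc-injective
            (trans (cong suc (∣-x∣ e∈S-g)) (trans (∣-x∣ g∈S) ∣S∣≡))))))))
        where
        g∈S : g ∈ S
        g∈S = p─q⊆p S _ g∈S-e
        e∈S-g : e ∈ S - g
        e∈S-g = x∈p∧x≢y⇒x∈p-y e∈S λ { refl → x∉-x S e g∈S-e }

  -- Parallel elements and edges of capacity 1

  t≡1⇒big : ∀ {h x y} → t h ≡ 1 → x ≢ y → x ∈ E h → y ∈ E h → Big h
  t≡1⇒big {h} t≡1 x≢y x∈ y∈ = subst (_< ∣ E h ∣) (sym t≡1) (two≤∣∣ x≢y x∈ y∈)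

  private
    ∣pair∣≡ : ∀ {h} {x y : Fin m} → t h ≡ 1 → x ≢ y → ∣ ⁅ x ⁆ ∪ ⁅ y ⁆ ∣ ≡ suc (t h)
    ∣pair∣≡ t≡1 x≢y = trans (∣pair∣ x≢y) (cong suc (sym t≡1))

  good⇒parallel : ∀ {l h x y} → Good l h → t h ≡ 1 → x ≢ y → x ∈ E h → y ∈ E h → Parallel l x y
  good⇒parallel good t≡1 x≢y x∈ y∈ = good-circuit good (pair⊆ x∈ y∈) (∣pair∣≡ t≡1 x≢y)

  -- The pair is a circuit in one colour only, and the colour of h is such a colour.
  parallel⇒good : ∀ {l h x y} → Parallel l x y → t h ≡ 1 → x ≢ y → x ∈ E h → y ∈ E h → Good l h
  parallel⇒good {h = h} par t≡1 x≢y x∈ y∈ =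
    let _ , good = good-exists (t≡1⇒big t≡1 x≢y x∈ y∈)
    in subst (λ l → Good l h)
         (unique-colour (edge-circuit h (pair⊆ x∈ y∈) (∣pair∣≡ t≡1 x≢y))
           (good⇒parallel good t≡1 x≢y x∈ y∈) par) good

  pair-prescribed : ∀ {x y} → x ≢ y → Prescribed H t (⁅ x ⁆ ∪ ⁅ y ⁆)
  pair-prescribed x≢y = size≤3 (≤-trans (≤-reflexive (∣pair∣ x≢y)) (s≤s (s≤s z≤n)))

  abstract
    -- Pairs fall under (a), so some edge has positive excess on the pair. With `t h ≥ 1` this
    -- requires both elements in `E h` and `t h ≡ 1`.
    parallel⇒edge : ∀ {l x y} → Parallel l x y → x ≢ y → ∃[ h ] t h ≡ 1 × x ∈ E h × y ∈ E h
    parallel⇒edge {l} {x} {y} par x≢y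
      with sum-pos (λ h → excess h (⁅ x ⁆ ∪ ⁅ y ⁆)) (<-≤-trans par (≤-trans
             (term≤sum (λ l → d l (⁅ x ⁆ ∪ ⁅ y ⁆)) l) (≤-reflexive (nullity-sum (pair-prescribed x≢y)))))
    ... | h , 0<excess with m∸n≢0⇒n<m (>⇒≢ 0<excess) | ⊆-witness (⁅ x ⁆ ∪ ⁅ y ⁆) (E h)
    ... | t<size | inj₁ ⊆Eh =
      h , ≤-antisym (s≤s⁻¹ (≤-trans t<size (≤-trans (∣p∩q∣≤∣p∣ (⁅ x ⁆ ∪ ⁅ y ⁆) (E h))
                     (≤-reflexive (∣pair∣ x≢y))))) (t-positive h) , ⊆Eh ∈₁ , ⊆Eh ∈₂
    ... | t<size | inj₂ (z , z∈ , z∉Eh) = contradiction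
      (≤-trans (s≤s (≤-trans (s≤s (t-positive h)) t<size)) (≤-trans
        (p⊂q⇒∣p∣<∣q∣ ((p∩q⊆p (⁅ x ⁆ ∪ ⁅ y ⁆) (E h)) , z , z∈ , z∉Eh ∘ ∈∩₂ {A = ⁅ x ⁆ ∪ ⁅ y ⁆}))
        (≤-reflexive (∣pair∣ x≢y)))) λ { (s≤s (s≤s ())) }

  -- Intersecting edges of the same colour yield a parallel pair

  Separated : Fin n → Fin n → Subset m → Set
  Separated i j A = ∀ {y} → y ∈ A → (y ∈ E i × y ∉ E j) ⊎ (y ∈ E j × y ∉ E i)

  separated⇒△ : ∀ {i j A} → Separated i j A → A ⊆ E i △ E j
  separated⇒△ {i} {j} sep y∈ with sep y∈
  ... | inj₁ (y∈Ei , y∉Ej) = ∈∪₁ (x∈p∧x∉q⇒x∈p─q y∈Ei y∉Ej)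
  ... | inj₂ (y∈Ej , y∉Ei) = ∈∪₂ {A = E i ─ E j} (x∈p∧x∉q⇒x∈p─q y∈Ej y∉Ei)

  -- Adding x to A raises the nullity of N l by 1.  Each excess it creates comes from an edge of
  -- capacity 1 through x and some y ∈ A ∩ E j, which makes x and y parallel in some colour.  If l
  -- were not among these colours, two such y would share a colour, hence be parallel themselves.
  abstract
    star : ∀ {l i j x A} → Nonempty (E i ∩ E j) → Separated i j (A ∪ ⁅ x ⁆) →
           ∣ (A ∪ ⁅ x ⁆) ∩ E i ∣ ≤ t i → ∣ (A ∪ ⁅ x ⁆) ∩ E j ∣ ≤ t j → Good l j → Big j →
           x ∉ A → x ∈ E i → d l A ≡ 0 → 0 < d l (A ∪ ⁅ x ⁆) →
           ∃[ y ] y ∈ A × y ∈ E j × Parallel l x y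
    star {l₀} {i} {j} {x} {A} meet sep ≤ti ≤tj good big x∉A x∈Ei d≡0 0<d =
      finish (collision F Δ F≤Δ sum-less)
      where
      A⁺ : Subset m
      A⁺ = A ∪ ⁅ x ⁆

      x∈A⁺ : x ∈ A⁺
      x∈A⁺ = ∈∪₂ {A = A} (x∈⁅x⁆ x)

      prescribed : ∀ {B} → B ⊆ A⁺ → Prescribed H t B
      prescribed {B} B⊆A⁺ = twoEdges i j meet (separated⇒△ {i} {j} (sep ∘ B⊆A⁺)) 
          (≤-trans (∣∩∣-monoˡ (E i) B⊆A⁺) ≤ti) (≤-trans (∣∩∣-monoˡ (E j) B⊆A⁺) ≤tj)

      Δ : Fin k → ℕ
      Δ l = d l A⁺ ∸ d l A

      gain : Fin n → ℕ
      gain h = excess h A⁺ ∸ excess h A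

      -- Column `zero` marks `l₀`, column `suc y` holds the nullities of the pair x, y. Gluing the
      -- pair to `A` at y keeps each entry below the gain `Δ l`, yet the table adds up to more than
      -- all gains.
      F : Fin k → Fin (suc m) → ℕ
      F l zero    = 𝟙 (l Fin.≟ l₀)
      F l (suc y) = if does (y ∈? A ∩ E j) then d l (⁅ x ⁆ ∪ ⁅ y ⁆) else 0

      F≤Δ : ∀ l y → F l y ≤ Δ l
      F≤Δ l zero = 𝟙≤ (l Fin.≟ l₀) λ { refl → subst (λ e → 1 ≤ d l A⁺ ∸ e) (sym d≡0) 0<d }
      F≤Δ l (suc y) with y ∈? A ∩ E j
      ... | no _ = z≤n
      ... | yes y∈ = m+n≤o⇒m≤o∸n (d l (⁅ x ⁆ ∪ ⁅ y ⁆))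
        (d-glue l {⁅ x ⁆ ∪ ⁅ y ⁆} {A} (∪-elim (pair⊆ x∈A⁺ (∈∪₁ (∈∩₁ y∈))) ∈∪₁) common)
        where
        common : ∀ {u} → u ∈ ⁅ x ⁆ ∪ ⁅ y ⁆ → u ∈ A → u ≡ y
        common u∈ u∈A with ∈pair⁻ u∈
        ... | inj₁ refl = contradiction u∈A x∉A
        ... | inj₂ u≡y  = u≡y

      x≢ : ∀ {y} → y ∈ A → x ≢ y
      x≢ y∈A refl = x∉A y∈A

      ∣A⁺∩E∣≤ : ∀ h → ∣ A⁺ ∩ E h ∣ ≤ suc ∣ A ∩ E h ∣
      ∣A⁺∩E∣≤ h = ≤-trans (p⊆q⇒∣p∣≤∣q∣ sub) (∣∪⁅⁆∣≤ (A ∩ E h) x)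
        where
        sub : A⁺ ∩ E h ⊆ (A ∩ E h) ∪ ⁅ x ⁆
        sub y∈ with x∈p∪q⁻ A ⁅ x ⁆ (∈∩₁ y∈)
        ... | inj₁ y∈A = ∈∪₁ (∈∩ y∈A (∈∩₂ {A = A⁺} y∈))
        ... | inj₂ y∈x = ∈∪₂ {A = A ∩ E h} y∈x

      -- An edge that gains contains x and is neither i nor j, which stay within capacity. By (H2)
      -- it meets `A` outside `E i`, hence inside `E j`, and there only once; so its capacity is 1.
      gain-witness : ∀ h → 0 < gain h → ∃[ y ] y ∈ A ∩ E j × 0 < excess h (⁅ x ⁆ ∪ ⁅ y ⁆)
      gain-witness h 0<gain =
        y , ∈∩ (∈∩₁ y∈) (proj₂ (at-j y∈)) ,
        m<n⇒0<n∸m (≤-trans (s≤s t≤1) (two≤∣∣ (x≢ (∈∩₁ y∈)) (∈∩ ∈₁ x∈Eh) (∈∩ ∈₂ (∈∩₂ {A = A} y∈))))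
        where
        0<excess : 0 < excess h A⁺
        0<excess = ≤-trans 0<gain (m∸n≤m (excess h A⁺) (excess h A))
        t<A⁺ : t h < ∣ A⁺ ∩ E h ∣
        t<A⁺ = m∸n≢0⇒n<m (>⇒≢ 0<excess)
        h≢i : h ≢ i
        h≢i refl = <⇒≱ t<A⁺ ≤ti
        x∈Eh : x ∈ E h
        x∈Eh with x ∈? E h
        ... | yes x∈Eh = x∈Eh
        ... | no x∉Eh  = contradiction (∸-monoˡ-≤ {∣ A⁺ ∩ E h ∣} (t h) (p⊆q⇒∣p∣≤∣q∣ same))
                                       (<⇒≱ (m∸n≢0⇒n<m (>⇒≢ 0<gain)))
          where
          same : A⁺ ∩ E h ⊆ A ∩ E h
          same y∈ with x∈p∪q⁻ A ⁅ x ⁆ (∈∩₁ y∈)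
          ... | inj₁ y∈A = ∈∩ y∈A (∈∩₂ {A = A⁺} y∈)
          ... | inj₂ y∈x = contradiction (subst (_∈ E h) (x∈⁅y⁆⇒x≡y x y∈x) (∈∩₂ {A = A⁺} y∈)) x∉Eh
        t≤A : t h ≤ ∣ A ∩ E h ∣
        t≤A = s≤s⁻¹ (≤-trans t<A⁺ (∣A⁺∩E∣≤ h))
        nonempty : Nonempty (A ∩ E h)
        nonempty = 0<∣∣⇒nonempty (A ∩ E h) (≤-trans (t-positive h) t≤A)
        y : Fin m
        y = proj₁ nonempty
        y∈ : y ∈ A ∩ E h
        y∈ = proj₂ nonempty
        at-j : ∀ {z} → z ∈ A ∩ E h → z ∈ E h × z ∈ E j
        at-j z∈ with sep (∈∪₁ (∈∩₁ z∈))
        ... | inj₂ (z∈Ej , _) = ∈∩₂ {A = A} z∈ , z∈Ej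
        ... | inj₁ (z∈Ei , _) = contradiction
          (same-edge (x≢ (∈∩₁ z∈)) x∈Eh (∈∩₂ {A = A} z∈) x∈Ei z∈Ei) h≢i
        h≢j : h ≢ j
        h≢j refl = <⇒≱ t<A⁺ ≤tj
        t≤1 : t h ≤ 1
        t≤1 = ≤-trans t≤A (≤-trans (p⊆q⇒∣p∣≤∣q∣ λ z∈ → let z∈Eh , z∈Ej = at-j z∈ in ∈∩ z∈Eh z∈Ej)
                                   (h2 h j h≢j))

      gain≤1 : ∀ h → gain h ≤ 1
      gain≤1 h = m≤n+o⇒m∸n≤o (excess h A⁺) (excess h A)
        (≤-trans (∸-monoˡ-≤ (t h) (∣A⁺∩E∣≤ h)) (m≤n+o⇒m∸n≤o (suc ∣ A ∩ E h ∣) (t h) (begin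
          suc ∣ A ∩ E h ∣              ≤⟨ s≤s (m≤n+m∸n (∣ A ∩ E h ∣) (t h)) ⟩
          suc (t h + excess h A)       ≡⟨ lem (t h) (excess h A) ⟩
          t h + (excess h A + 1)       ∎)))
        where
        open ≤-Reasoning
        lem : ∀ a b → suc (a + b) ≡ a + (b + 1)
        lem = solve-∀

      G : Fin n → Fin m → ℕ
      G h y = if does (y ∈? A ∩ E j) then excess h (⁅ x ⁆ ∪ ⁅ y ⁆) else 0

      gain≤G : ∀ h → gain h ≤ sum (G h)
      gain≤G h with gain h | gain≤1 h | gain-witness h
      ... | zero  | _  | _ = z≤n
      ... | suc _ | ≤1 | witness =
        let y , y∈ , 0<excess = witness (s≤s z≤n)
        in ≤-trans ≤1 (≤-trans (0<G y y∈ 0<excess) (term≤sum (G h) y))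
        where
        0<G : ∀ y → y ∈ A ∩ E j → 0 < excess h (⁅ x ⁆ ∪ ⁅ y ⁆) → 0 < G h y
        0<G y y∈ 0<excess with y ∈? A ∩ E j
        ... | yes _  = 0<excess
        ... | no y∉  = contradiction y∈ y∉

      F≡G : ∀ y → sum (λ l → F l (suc y)) ≡ sum (λ h → G h y)
      F≡G y with y ∈? A ∩ E j
      ... | yes y∈ = nullity-sum (pair-prescribed (x≢ (∈∩₁ y∈)))
      ... | no _   = trans (sum-replicate-zero k) (sym (sum-replicate-zero n))

      A⊆A⁺ : A ⊆ A⁺
      A⊆A⁺ = ∈∪₁

      excess-mono : ∀ h → excess h A ≤ excess h A⁺
      excess-mono h = ∸-monoˡ-≤ (t h) (∣∩∣-monoˡ (E h) A⊆A⁺)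

      ∑Δ≡∑gain : sum Δ ≡ sum gain
      ∑Δ≡∑gain = +-cancelʳ-≡ (sum (λ h → excess h A)) _ _ (begin
        sum Δ + sum (λ h → excess h A)     ≡⟨ cong (sum Δ +_) (nullity-sum (prescribed A⊆A⁺)) ⟨
        sum Δ + sum (λ l → d l A)          ≡⟨ sum-∸ (λ l → d l A⁺) (λ l → d l A) (λ l → d-mono l A⊆A⁺) ⟩
        sum (λ l → d l A⁺)                 ≡⟨ nullity-sum (prescribed id) ⟩
        sum (λ h → excess h A⁺)            ≡⟨ sum-∸ (λ h → excess h A⁺) (λ h → excess h A) excess-mono ⟨
        sum gain + sum (λ h → excess h A)  ∎)
        where open ≡-Reasoning

      first : 1 ≤ sum (λ l → F l zero)
      first = ≤-trans (𝟙-pos⁺ (l₀ Fin.≟ l₀) refl) (term≤sum (λ l → F l zero) l₀)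

      sum-less : sum Δ < sum (λ y → sum (λ l → F l y))
      sum-less = begin
        1 + sum Δ                                     ≡⟨ cong suc ∑Δ≡∑gain ⟩
        1 + sum gain                                  ≤⟨ +-mono-≤ first (sum-mono gain≤G) ⟩
        F₀ + sum (λ h → sum (G h))                    ≡⟨ cong (F₀ +_) (∑-comm G) ⟩
        F₀ + sum (λ y → sum (λ h → G h y))            ≡⟨ cong (F₀ +_) (sum-cong-≗ F≡G) ⟨
        F₀ + sum (λ y → sum (λ l → F l (suc y)))      ∎
        where
        open ≤-Reasoning
        F₀ : ℕ
        F₀ = sum (λ l → F l zero)

      F-zero : ∀ l → 0 < F l zero → l ≡ l₀
      F-zero l = 𝟙-pos⁻ (l Fin.≟ l₀)

      F-suc : ∀ l y → 0 < F l (suc y) → y ∈ A × y ∈ E j × Parallel l x y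
      F-suc l y 0<F with y ∈? A ∩ E j
      ... | yes y∈ = ∈∩₁ y∈ , ∈∩₂ {A = A} y∈ , 0<F

      finish : ∃[ l ] ∃[ p ] ∃[ q ] p ≢ q × 0 < F l p × 0 < F l q → ∃[ y ] y ∈ A × y ∈ E j × Parallel l₀ x y
      finish (l , zero  , zero  , p≢q , _   , _)   = contradiction refl p≢q
      finish (l , zero  , suc y , _   , 0<p , 0<q) with refl ← F-zero l 0<p = y , F-suc l y 0<q
      finish (l , suc y , zero  , _   , 0<p , 0<q) with refl ← F-zero l 0<q = y , F-suc l y 0<p
      finish (l , suc y , suc z , p≢q , 0<p , 0<q) with l Fin.≟ l₀ | F-suc l y 0<p | F-suc l z 0<q
      ... | yes refl | found             | _ = y , found
      -- The parallel pair y, z lies in an edge of capacity 1, which by (H2) is j itself; then j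
      -- would be good for two colours.
      ... | no l≢l₀  | y∈A , y∈Ej , xy | z∈A , z∈Ej , xz =
        let y≢z = p≢q ∘ cong suc
            yz = parallel-trans l (parallel-sym l xy) xz y≢z
            h , t≡1 , y∈Eh , z∈Eh = parallel⇒edge yz y≢z
            good′ = subst (Good l) (same-edge y≢z y∈Eh z∈Eh y∈Ej z∈Ej)
                      (parallel⇒good yz t≡1 y≢z y∈Eh z∈Eh)
        in contradiction (good-unique big good′ good) l≢l₀

  abstract
    -- `B ∪ ⁅ a ⁆` and `C ∪ ⁅ a ⁆` are circuits in colour l sharing only a, so their union has
    -- nullity at least 2, and at least 1 without a. Taking exactly `t i` and `t j` elements keeps
    -- every subset of `B ∪ C` within the capacities that (d) demands. `star` then applies where the
    -- nullity first becomes positive, on whichever side the last element lies.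
    conflict : ∀ {l i j a} → i ≢ j → Big i → Big j → a ∈ E i → a ∈ E j → Good l i → Good l j →
               ∃[ b ] ∃[ c ] b ∈ E i × b ≢ a × c ∈ E j × c ≢ a × Parallel l b c
    conflict {l} {i} {j} {a} i≢j big-i big-j a∈Ei a∈Ej good-i good-j
      with intermediate ⊥ (E i - a) (t i) ⊥⊆ (≤-trans (≤-reflexive (∣⊥∣≡0 m)) z≤n)
             (s≤s⁻¹ (≤-trans big-i (≤-reflexive (sym (∣-x∣ a∈Ei)))))
         | intermediate ⊥ (E j - a) (t j) ⊥⊆ (≤-trans (≤-reflexive (∣⊥∣≡0 m)) z≤n)
             (s≤s⁻¹ (≤-trans big-j (≤-reflexive (sym (∣-x∣ a∈Ej)))))
    ... | B , _ , B⊆ , ∣B∣≡ | C , _ , C⊆ , ∣C∣≡ = jump (d-jump l (B ∪ C) 0<dBC)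
      where
      only-a : ∀ {y} → y ∈ E i → y ∈ E j → y ≡ a
      only-a y∈Ei y∈Ej = ∣∣≤1⇒≡ (h2 i j i≢j) (∈∩ y∈Ei y∈Ej) (∈∩ a∈Ei a∈Ej)

      B⊆Ei : B ⊆ E i
      B⊆Ei y∈ = p─q⊆p (E i) _ (B⊆ y∈)
      C⊆Ej : C ⊆ E j
      C⊆Ej y∈ = p─q⊆p (E j) _ (C⊆ y∈)
      a∉B : a ∉ B
      a∉B a∈B = x∉-x (E i) a (B⊆ a∈B)
      a∉C : a ∉ C
      a∉C a∈C = x∉-x (E j) a (C⊆ a∈C)
      Ba⊆ : B ∪ ⁅ a ⁆ ⊆ E i
      Ba⊆ = ∪-elim B⊆Ei (⁅⁆⊆ a∈Ei)
      Ca⊆ : C ∪ ⁅ a ⁆ ⊆ E j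
      Ca⊆ = ∪-elim C⊆Ej (⁅⁆⊆ a∈Ej)

      0<dBC : 0 < d l (B ∪ C)
      0<dBC = s≤s⁻¹ (≤-trans (≤-trans
        (+-mono-≤ (good-circuit good-i Ba⊆ (trans (∣∪⁅⁆∣ a∉B) (cong suc ∣B∣≡)))
                  (good-circuit good-j Ca⊆ (trans (∣∪⁅⁆∣ a∉C) (cong suc ∣C∣≡))))
        (d-glue l {B ∪ ⁅ a ⁆} {C ∪ ⁅ a ⁆} {(B ∪ C) ∪ ⁅ a ⁆}
          (∪-elim (∪-elim (∈∪₁ ∘ ∈∪₁) (∈∪₂ {A = B ∪ C})) (∪-elim (∈∪₁ ∘ ∈∪₂ {A = B}) (∈∪₂ {A = B ∪ C})))
          λ y∈B y∈C → only-a (Ba⊆ y∈B) (Ca⊆ y∈C))) (d-step l (B ∪ C) a))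

      sep : Separated i j (B ∪ C)
      sep y∈ with x∈p∪q⁻ B C y∈
      ... | inj₁ y∈B = inj₁ (B⊆Ei y∈B , λ y∈Ej → a∉B (subst (_∈ B) (only-a (B⊆Ei y∈B) y∈Ej) y∈B))
      ... | inj₂ y∈C = inj₂ (C⊆Ej y∈C , λ y∈Ei → a∉C (subst (_∈ C) (only-a y∈Ei (C⊆Ej y∈C)) y∈C))

      a∉ : ∀ {y} → y ∈ B ∪ C → y ≢ a
      a∉ y∈ refl with x∈p∪q⁻ B C y∈
      ... | inj₁ a∈B = a∉B a∈B
      ... | inj₂ a∈C = a∉C a∈C

      ∣BC∩Ei∣ : ∣ (B ∪ C) ∩ E i ∣ ≤ t i
      ∣BC∩Ei∣ = ≤-trans (p⊆q⇒∣p∣≤∣q∣ sub) (≤-reflexive ∣B∣≡)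
        where
        sub : (B ∪ C) ∩ E i ⊆ B
        sub y∈ with x∈p∪q⁻ B C (∈∩₁ y∈)
        ... | inj₁ y∈B = y∈B
        ... | inj₂ y∈C = contradiction (only-a (∈∩₂ {A = B ∪ C} y∈) (C⊆Ej y∈C)) (a∉ (∈∩₁ y∈))

      ∣BC∩Ej∣ : ∣ (B ∪ C) ∩ E j ∣ ≤ t j
      ∣BC∩Ej∣ = ≤-trans (p⊆q⇒∣p∣≤∣q∣ sub) (≤-reflexive ∣C∣≡)
        where
        sub : (B ∪ C) ∩ E j ⊆ C
        sub y∈ with x∈p∪q⁻ B C (∈∩₁ y∈)
        ... | inj₂ y∈C = y∈C
        ... | inj₁ y∈B = contradiction (only-a (B⊆Ei y∈B) (∈∩₂ {A = B ∪ C} y∈)) (a∉ (∈∩₁ y∈))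

      jump : ∃[ A ] ∃[ x ] A ∪ ⁅ x ⁆ ⊆ B ∪ C × x ∉ A × d l A ≡ 0 × 0 < d l (A ∪ ⁅ x ⁆) →
             ∃[ b ] ∃[ c ] b ∈ E i × b ≢ a × c ∈ E j × c ≢ a × Parallel l b c
      jump (A , x , Ax⊆ , x∉A , d≡0 , 0<d) with sep (Ax⊆ (∈∪₂ {A = A} (x∈⁅x⁆ x)))
      ... | inj₁ (x∈Ei , _) =
        let y , y∈A , y∈Ej , xy = star (a , ∈∩ a∈Ei a∈Ej) (sep ∘ Ax⊆) 
                                    (≤-trans (∣∩∣-monoˡ (E i) Ax⊆) ∣BC∩Ei∣) (≤-trans (∣∩∣-monoˡ (E j) Ax⊆) ∣BC∩Ej∣)
                                    good-j big-j x∉A x∈Ei d≡0 0<d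
        in x , y , x∈Ei , a∉ (Ax⊆ (∈∪₂ {A = A} (x∈⁅x⁆ x))) , y∈Ej , a∉ (Ax⊆ (∈∪₁ y∈A)) , xy
      ... | inj₂ (x∈Ej , _) =
        let y , y∈A , y∈Ei , xy = star (a , ∈∩ a∈Ej a∈Ei) (Sum.swap ∘ sep ∘ Ax⊆) 
                                    (≤-trans (∣∩∣-monoˡ (E j) Ax⊆) ∣BC∩Ej∣) (≤-trans (∣∩∣-monoˡ (E i) Ax⊆) ∣BC∩Ei∣)
                                    good-i big-i x∉A x∈Ej d≡0 0<d
        in y , x , y∈Ei , a∉ (Ax⊆ (∈∪₁ y∈A)) , x∈Ej , a∉ (Ax⊆ (∈∪₂ {A = A} (x∈⁅x⁆ x))) , parallel-sym l xy

  -- Triangles of edges of capacity 1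

  excess-pair : ∀ {h x y} → t h ≡ 1 → x ≢ y → x ∈ E h → y ∈ E h →
                sum (λ f → excess f (⁅ x ⁆ ∪ ⁅ y ⁆)) ≡ 1
  excess-pair {h} t≡1 x≢y x∈ y∈ = trans (excess-edge h (pair⊆ x∈ y∈)) (cong₂ _∸_ (∣pair∣ x≢y) t≡1)

  ⟦_,_,_⟧ : Fin m → Fin m → Fin m → Subset m
  ⟦ x , y , z ⟧ = (⁅ x ⁆ ∪ ⁅ y ⁆) ∪ ⁅ z ⁆

  ∈triple⁻ : ∀ {x y z u} → u ∈ ⟦ x , y , z ⟧ → u ≡ x ⊎ u ≡ y ⊎ u ≡ z
  ∈triple⁻ {x} {y} {z} u∈ with x∈p∪q⁻ (⁅ x ⁆ ∪ ⁅ y ⁆) ⁅ z ⁆ u∈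
  ... | inj₂ u∈z = inj₂ (inj₂ (x∈⁅y⁆⇒x≡y z u∈z))
  ... | inj₁ u∈xy with ∈pair⁻ u∈xy
  ...   | inj₁ u≡x = inj₁ u≡x
  ...   | inj₂ u≡y = inj₂ (inj₁ u≡y)

  ∣triple∣ : ∀ {x y z} → x ≢ y → x ≢ z → y ≢ z → ∣ ⟦ x , y , z ⟧ ∣ ≡ 3
  ∣triple∣ {x} {y} {z} x≢y x≢z y≢z = trans (∣∪⁅⁆∣ z∉) (cong suc (∣pair∣ x≢y))
    where
    z∉ : z ∉ ⁅ x ⁆ ∪ ⁅ y ⁆
    z∉ z∈ with ∈pair⁻ z∈
    ... | inj₁ z≡x = x≢z (sym z≡x)
    ... | inj₂ z≡y = y≢z (sym z≡y)

  triple⊆ : ∀ {x y z} {A : Subset m} → x ∈ A → y ∈ A → z ∈ A → ⟦ x , y , z ⟧ ⊆ A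
  triple⊆ x∈ y∈ z∈ = ∪-elim (pair⊆ x∈ y∈) (⁅⁆⊆ z∈)

  -- A colour contributes at most 2 to the total excess 3 of the triple.
  abstract
    second-colour : ∀ {p q r x y z} → p ≢ q → p ≢ r → q ≢ r → t p ≡ 1 → t q ≡ 1 → t r ≡ 1 →
                    x ≢ y → x ≢ z → y ≢ z → x ∈ E p → y ∈ E p → x ∈ E q → z ∈ E q →
                    y ∈ E r → z ∈ E r → ∀ l → ∃[ l′ ] l′ ≢ l × 0 < d l′ ⟦ x , y , z ⟧
    second-colour {p} {q} {r} {x} {y} {z} p≢q p≢r q≢r tp tq tr x≢y x≢z y≢z xp yp xq zq yr zr l =
      let l′ , f<d = sum-<⇒∃ f (λ l → d l S) ∑f<∑d in l′ , other l′ f<d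
      where
      S : Subset m
      S = ⟦ x , y , z ⟧
      x∈S : x ∈ S
      x∈S = ∈∪₁ ∈₁
      y∈S : y ∈ S
      y∈S = ∈∪₁ ∈₂
      z∈S : z ∈ S
      z∈S = ∈∪₂ {A = ⁅ x ⁆ ∪ ⁅ y ⁆} (x∈⁅x⁆ z)
      -- All of `f` sits at l, so wherever `f` falls below the nullity at `S` in spite of this, the
      -- colour is a different one.
      f : Fin k → ℕ
      f l′ = if does (l Fin.≟ l′) then d l S else 0
      other : ∀ l′ → f l′ < d l′ S → l′ ≢ l × 0 < d l′ S
      other l′ f<d with l Fin.≟ l′
      ... | yes refl = contradiction f<d (<-irrefl refl)
      ... | no l≢l′  = l≢l′ ∘ sym , f<d
      d≤2 : d l S ≤ 2
      d≤2 = linear 0 (+-mono-≤ (subst₂ _≤_ (cong (d l S +_) (∣⁅x⁆∣≡1 x))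
          (cong₂ _+_ (d-⁅⁆ l x) (∣triple∣ x≢y x≢z y≢z)) (d-lipschitz l (⁅⁆⊆ {A = S} x∈S))) (z≤n {0}))
        (lem (d l S))
        where
        lem : ∀ a → a + 3 + 0 ≡ 2 + (a + 1 + 0)
        lem = solve-∀
      positive : ∀ {h u v} → t h ≡ 1 → u ≢ v → u ∈ S → v ∈ S → u ∈ E h → v ∈ E h → 1 ≤ excess h S
      positive {h} th u≢v u∈S v∈S u∈E v∈E =
        m<n⇒0<n∸m (subst (_< ∣ S ∩ E h ∣) (sym th) (two≤∣∣ u≢v (∈∩ u∈S u∈E) (∈∩ v∈S v∈E)))
      ∑f<∑d : sum f < sum (λ l → d l S)
      ∑f<∑d = begin
        1 + sum f                                     ≡⟨ cong suc (sum-at l (d l S)) ⟩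
        1 + d l S                                     ≤⟨ s≤s d≤2 ⟩
        3                                             ≤⟨ +-mono-≤ (positive tp x≢y x∈S y∈S xp yp)
                                                          (+-mono-≤ (positive tq x≢z x∈S z∈S xq zq)
                                                            (+-monoˡ-≤ 0 (positive tr y≢z y∈S z∈S yr zr))) ⟩
        ∑[ (λ h → excess h S) ] (p ∷ q ∷ r ∷ [])      ≤⟨ sum-unique (λ h → excess h S)
                                                          ((p≢q ∷ p≢r ∷ []) ∷ (q≢r ∷ []) ∷ [] ∷ []) ⟩
        sum (λ h → excess h S)                        ≡⟨ nullity-sum (size≤3 (≤-reflexive (∣triple∣ x≢y x≢z y≢z))) ⟨
        sum (λ l → d l S)                             ∎
        where open ≤-Reasoning

  -- The total nullity of {a, b, e, c} is at most 5, but the colour l contributes 3 and three other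
  -- colours contribute 1 each.
  no-triangle : ∀ {l i j h a b c e} → i ≢ j → i ≢ h → j ≢ h → t i ≡ 1 → t j ≡ 1 → t h ≡ 1 →
                a ≢ b → a ≢ c → b ≢ c → a ≢ e → b ≢ e →
                a ∈ E i → b ∈ E i → e ∈ E i → a ∈ E j → c ∈ E j → b ∈ E h → c ∈ E h →
                Good l i → Good l j → Good l h → Empty.⊥
  no-triangle {l} {i} {j} {h} {a} {b} {c} {e} i≢j i≢h j≢h ti tj th a≢b a≢c b≢c a≢e b≢e
              ai bi ei aj cj bh ch good-i good-j good-h = contradiction six≤five λ
                { (s≤s (s≤s (s≤s (s≤s (s≤s ()))))) }
    where
    b∉j : b ∉ E j
    b∉j bj = i≢j (same-edge a≢b ai bi aj bj)
    e∉j : e ∉ E j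
    e∉j ej = i≢j (same-edge a≢e ai ei aj ej)
    a∉h : a ∉ E h
    a∉h ah = i≢h (same-edge a≢b ai bi ah bh)
    e∉h : e ∉ E h
    e∉h eh = i≢h (same-edge b≢e bi ei bh eh)
    c∉i : c ∉ E i
    c∉i ci = i≢j (same-edge a≢c ai ci aj cj)
    e≢c : e ≢ c
    e≢c refl = c∉i ei

    ac : Parallel l a c
    ac = good⇒parallel good-j tj a≢c aj cj
    bc : Parallel l b c
    bc = good⇒parallel good-h th b≢c bh ch
    ec : Parallel l e c
    ec = parallel-trans l (good⇒parallel good-i ti (a≢e ∘ sym) ei ai) ac e≢c

    -- The parallel pair e, c needs an edge of its own, which is a fourth one: i misses c, while j
    -- and h miss e.
    edge-ec : ∃[ g ] t g ≡ 1 × e ∈ E g × c ∈ E g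
    edge-ec = parallel⇒edge ec e≢c
    g : Fin n
    g = proj₁ edge-ec
    tg : t g ≡ 1
    tg = proj₁ (proj₂ edge-ec)
    eg : e ∈ E g
    eg = proj₁ (proj₂ (proj₂ edge-ec))
    cg : c ∈ E g
    cg = proj₂ (proj₂ (proj₂ edge-ec))
    i≢g : i ≢ g
    i≢g i≡g = c∉i (subst (λ f → c ∈ E f) (sym i≡g) cg)
    j≢g : j ≢ g
    j≢g j≡g = e∉j (subst (λ f → e ∈ E f) (sym j≡g) eg)
    h≢g : h ≢ g
    h≢g h≡g = e∉h (subst (λ f → e ∈ E f) (sym h≡g) eg)

    P A : Subset m
    P = ⟦ a , b , e ⟧
    A = P ∪ ⁅ c ⁆
    a∈A : a ∈ A
    a∈A = ∈∪₁ (∈∪₁ ∈₁)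
    b∈A : b ∈ A
    b∈A = ∈∪₁ (∈∪₁ ∈₂)
    e∈A : e ∈ A
    e∈A = ∈∪₁ (∈∪₂ {A = ⁅ a ⁆ ∪ ⁅ b ⁆} (x∈⁅x⁆ e))
    c∈A : c ∈ A
    c∈A = ∈∪₂ {A = P} (x∈⁅x⁆ c)
    P⊆i : P ⊆ E i
    P⊆i = triple⊆ ai bi ei
    ∣P∣≡3 : ∣ P ∣ ≡ 3
    ∣P∣≡3 = ∣triple∣ a≢b a≢e b≢e

    -- This is (b): among i, j, h the element e lies only in i, whereas a, b and c lie in two edges
    -- each.
    prescribed : Prescribed H t A
    prescribed = triangle (trans (∣∪⁅⁆∣ (c∉i ∘ P⊆i)) (cong suc ∣P∣≡3)) i j h i≢j i≢h j≢h ti tj th e e∈A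
      (cong List.length (trans (filter-accept (e ∈E?_) ei)
        (cong (i ∷_) (trans (filter-reject (e ∈E?_) e∉j) (filter-reject (e ∈E?_) e∉h))))) two
      where
      _∈E?_ : (x : Fin m) (f : Fin n) → _
      x ∈E? f = x ∈? E f
      two : ∀ {x} → x ∈ A → x ≢ e → degreeIn H (i ∷ j ∷ h ∷ []) x ≡ 2
      two x∈A x≢e with x∈p∪q⁻ P ⁅ c ⁆ x∈A
      ... | inj₂ x∈c with refl ← x∈⁅y⁆⇒x≡y c x∈c = cong List.length
        (trans (filter-reject (c ∈E?_) c∉i)
          (trans (filter-accept (c ∈E?_) cj) (cong (j ∷_) (filter-accept (c ∈E?_) ch))))
      ... | inj₁ x∈P with ∈triple⁻ x∈P
      ...   | inj₁ refl = cong List.length (trans (filter-accept (a ∈E?_) ai)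
                (cong (i ∷_) (trans (filter-accept (a ∈E?_) aj)
                  (cong (j ∷_) (filter-reject (a ∈E?_) a∉h)))))
      ...   | inj₂ (inj₁ refl) = cong List.length (trans (filter-accept (b ∈E?_) bi)
                (cong (i ∷_) (trans (filter-reject (b ∈E?_) b∉j) (filter-accept (b ∈E?_) bh))))
      ...   | inj₂ (inj₂ x≡e) = contradiction x≡e x≢e

    dP≥2 : 2 ≤ d l P
    dP≥2 = +-cancelʳ-≤ 1 2 (d l P) (subst₂ (λ s u → s ≤ d l P + u) ∣P∣≡3 ti (good-⊆ good-i P⊆i))

    dA≥3 : 3 ≤ d l A
    dA≥3 = ≤-trans (+-mono-≤ dP≥2 ac) (d-glue l {P} {⁅ a ⁆ ∪ ⁅ c ⁆} {A} (∪-elim ∈∪₁ (pair⊆ a∈A c∈A)) common)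
      where
      common : ∀ {u} → u ∈ P → u ∈ ⁅ a ⁆ ∪ ⁅ c ⁆ → u ≡ a
      common u∈P u∈ with ∈pair⁻ u∈
      ... | inj₁ u≡a = u≡a
      ... | inj₂ refl = contradiction (P⊆i u∈P) c∉i

    -- Two of the triples with the same further colour l′ give A nullity 2, hence P nullity 1.
    distinct : ∀ {l′ x y z} → l′ ≢ l → x ∈ P → y ∈ P → z ∈ P → y ≢ z → Parallel l x c →
               sum (λ l → d l (⁅ x ⁆ ∪ ⁅ c ⁆)) ≡ 1 →
               0 < d l′ ⟦ x , y , c ⟧ → 0 < d l′ ⟦ x , z , c ⟧ → Empty.⊥
    distinct {l′} {x} {y} {z} l′≢l x∈P y∈P z∈P y≢z xc ∑≡1 0<d₁ 0<d₂ = contradiction (begin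
      3                                     ≤⟨ +-mono-≤ dP≥2 (+-monoˡ-≤ 0 dP) ⟩
      ∑[ (λ l → d l P) ] (l ∷ l′ ∷ [])      ≤⟨ sum-unique (λ l → d l P) (((l′≢l ∘ sym) ∷ []) ∷ [] ∷ []) ⟩
      sum (λ l → d l P)                     ≡⟨ nullity-sum (size≤3 (≤-reflexive ∣P∣≡3)) ⟩
      sum (λ f → excess f P)                ≡⟨ excess-edge i P⊆i ⟩
      ∣ P ∣ ∸ t i                           ≡⟨ cong₂ _∸_ ∣P∣≡3 ti ⟩
      2                                     ∎) λ { (s≤s (s≤s ())) }
      where
      open ≤-Reasoning
      meet : ⟦ x , y , c ⟧ ∩ ⟦ x , z , c ⟧ ⊆ ⁅ x ⁆ ∪ ⁅ c ⁆
      meet u∈ with ∈triple⁻ (∈∩₁ u∈) | ∈triple⁻ (∈∩₂ {A = ⟦ x , y , c ⟧} u∈)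
      ... | inj₁ refl        | _                = ∈₁
      ... | inj₂ (inj₂ refl) | _                = ∈₂
      ... | inj₂ (inj₁ refl) | inj₁ refl        = ∈₁
      ... | inj₂ (inj₁ refl) | inj₂ (inj₂ refl) = ∈₂
      ... | inj₂ (inj₁ u≡y)  | inj₂ (inj₁ u≡z)  = contradiction (trans (sym u≡y) u≡z) y≢z
      xc≡0 : d l′ (⁅ x ⁆ ∪ ⁅ c ⁆) ≡ 0
      xc≡0 = n≤0⇒n≡0 (≮⇒≥ λ 0<d → l′≢l (unique-colour ∑≡1 0<d xc))
      dA≥2 : 2 ≤ d l′ A
      dA≥2 = linear 0 (+-mono-≤ (+-mono-≤ 0<d₁ 0<d₂) (+-mono-≤
          (d-super l′ {⟦ x , y , c ⟧} {⟦ x , z , c ⟧} {A}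
            (∪-elim (triple⊆ (∈∪₁ x∈P) (∈∪₁ y∈P) c∈A) (triple⊆ (∈∪₁ x∈P) (∈∪₁ z∈P) c∈A)))
          (≤-trans (d-mono l′ meet) (≤-reflexive xc≡0))))
        (lem (d l′ ⟦ x , y , c ⟧) (d l′ ⟦ x , z , c ⟧) (d l′ A) (d l′ (⟦ x , y , c ⟧ ∩ ⟦ x , z , c ⟧)))
        where
        lem : ∀ p q r s → 2 + (p + q + (r + s + 0)) + 0 ≡ r + (2 + (p + q + s))
        lem = solve-∀
      dP : 1 ≤ d l′ P
      dP = s≤s⁻¹ (≤-trans dA≥2 (d-step l′ P c))

    swap₁₂ : ∀ l′ x y z → 0 < d l′ ⟦ x , y , z ⟧ → 0 < d l′ ⟦ y , x , z ⟧
    swap₁₂ l′ x y z = subst (λ S → 0 < d l′ (S ∪ ⁅ z ⁆)) (∪-comm ⁅ x ⁆ ⁅ y ⁆)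

    a∈P : a ∈ P
    a∈P = ∈∪₁ ∈₁
    b∈P : b ∈ P
    b∈P = ∈∪₁ ∈₂
    e∈P : e ∈ P
    e∈P = ∈∪₂ {A = ⁅ a ⁆ ∪ ⁅ b ⁆} (x∈⁅x⁆ e)

    pair-sum : ∀ {f x} → t f ≡ 1 → x ≢ c → x ∈ E f → c ∈ E f → sum (λ l → d l (⁅ x ⁆ ∪ ⁅ c ⁆)) ≡ 1
    pair-sum tf x≢c xf cf = trans (nullity-sum (pair-prescribed x≢c)) (excess-pair tf x≢c xf cf)

    six≤∑ : ∀ {l₁ l₂ l₃} → l₁ ≢ l → l₂ ≢ l → l₃ ≢ l → 0 < d l₁ ⟦ a , b , c ⟧ →
            0 < d l₂ ⟦ a , e , c ⟧ → 0 < d l₃ ⟦ b , e , c ⟧ → 6 ≤ sum (λ l → d l A)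
    six≤∑ {l₁} {l₂} {l₃} l₁≢l l₂≢l l₃≢l 0<d₁ 0<d₂ 0<d₃ = ≤-trans
      (+-mono-≤ dA≥3 (+-mono-≤ (up l₁ a∈A b∈A 0<d₁) (+-mono-≤ (up l₂ a∈A e∈A 0<d₂)
        (+-monoˡ-≤ 0 (up l₃ b∈A e∈A 0<d₃)))))
      (sum-unique (λ l → d l A) {l ∷ l₁ ∷ l₂ ∷ l₃ ∷ []}
        (((l₁≢l ∘ sym) ∷ (l₂≢l ∘ sym) ∷ (l₃≢l ∘ sym) ∷ []) ∷ (l₁≢l₂ ∷ l₁≢l₃ ∷ []) ∷ (l₂≢l₃ ∷ []) ∷ [] ∷ []))
      where
      up : ∀ l′ {x y} → x ∈ A → y ∈ A → 0 < d l′ ⟦ x , y , c ⟧ → 1 ≤ d l′ A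
      up l′ x∈A y∈A 0<d = ≤-trans 0<d (d-mono l′ (triple⊆ x∈A y∈A c∈A))
      l₁≢l₂ : l₁ ≢ l₂
      l₁≢l₂ refl = distinct l₁≢l a∈P b∈P e∈P b≢e ac (pair-sum tj a≢c aj cj) 0<d₁ 0<d₂
      l₁≢l₃ : l₁ ≢ l₃
      l₁≢l₃ refl = distinct l₁≢l b∈P a∈P e∈P a≢e bc (pair-sum th b≢c bh ch) (swap₁₂ l₁ a b c 0<d₁) 0<d₃
      l₂≢l₃ : l₂ ≢ l₃
      l₂≢l₃ refl = distinct l₂≢l e∈P a∈P b∈P a≢b ec (pair-sum tg e≢c eg cg)
                     (swap₁₂ l₂ a e c 0<d₂) (swap₁₂ l₂ b e c 0<d₃)

    -- An edge missing c meets `A` inside `P`; an edge through c contains at most one of a, b, e,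
    -- since two of them would make it i. Hence the total 5: 2 from `P` and 1 from each of the three
    -- pairs with c.
    bound : Fin n → ℕ
    bound f = excess f P + (excess f (⁅ a ⁆ ∪ ⁅ c ⁆) + (excess f (⁅ b ⁆ ∪ ⁅ c ⁆) + excess f (⁅ e ⁆ ∪ ⁅ c ⁆)))

    excess-⊆ : ∀ {f B} → A ∩ E f ⊆ B → excess f A ≤ excess f B
    excess-⊆ {f} ⊆B = ∸-monoˡ-≤ (t f) (p⊆q⇒∣p∣≤∣q∣ λ x∈ → ∈∩ (⊆B x∈) (∈∩₂ {A = A} x∈))

    ∈A⁻ : ∀ {x} → x ∈ A → x ≡ a ⊎ x ≡ b ⊎ x ≡ e ⊎ x ≡ c
    ∈A⁻ x∈ with x∈p∪q⁻ P ⁅ c ⁆ x∈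
    ... | inj₂ x∈c = inj₂ (inj₂ (inj₂ (x∈⁅y⁆⇒x≡y c x∈c)))
    ... | inj₁ x∈P with ∈triple⁻ x∈P
    ...   | inj₁ x≡a = inj₁ x≡a
    ...   | inj₂ (inj₁ x≡b) = inj₂ (inj₁ x≡b)
    ...   | inj₂ (inj₂ x≡e) = inj₂ (inj₂ (inj₁ x≡e))

    excess≤bound : ∀ f → excess f A ≤ bound f
    excess≤bound f with c ∈? E f
    ... | no c∉f = ≤-trans (excess-⊆ sub) (m≤m+n _ _)
      where
      sub : A ∩ E f ⊆ P
      sub x∈ with x∈p∪q⁻ P ⁅ c ⁆ (∈∩₁ x∈)
      ... | inj₁ x∈P = x∈P
      ... | inj₂ x∈c = contradiction (subst (_∈ E f) (x∈⁅y⁆⇒x≡y c x∈c) (∈∩₂ {A = A} x∈)) c∉f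
    ... | yes cf with a ∈? E f | b ∈? E f | e ∈? E f
    ...   | yes af | _ | _ with refl ← same-edge a≢c af cf aj cj =
      ≤-trans (excess-⊆ sub) (≤-trans (m≤m+n _ _) (m≤n+m _ (excess j P)))
      where
      sub : A ∩ E j ⊆ ⁅ a ⁆ ∪ ⁅ c ⁆
      sub x∈ with ∈A⁻ (∈∩₁ x∈)
      ... | inj₁ refl = ∈₁
      ... | inj₂ (inj₁ refl) = contradiction (∈∩₂ {A = A} x∈) b∉j
      ... | inj₂ (inj₂ (inj₁ refl)) = contradiction (∈∩₂ {A = A} x∈) e∉j
      ... | inj₂ (inj₂ (inj₂ refl)) = ∈₂
    ...   | no a∉f | yes bf | _ with refl ← same-edge b≢c bf cf bh ch =
      ≤-trans (excess-⊆ sub) (≤-trans (m≤m+n _ _) (≤-trans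
        (m≤n+m _ (excess h (⁅ a ⁆ ∪ ⁅ c ⁆))) (m≤n+m _ (excess h P))))
      where
      sub : A ∩ E h ⊆ ⁅ b ⁆ ∪ ⁅ c ⁆
      sub x∈ with ∈A⁻ (∈∩₁ x∈)
      ... | inj₁ refl = contradiction (∈∩₂ {A = A} x∈) a∉h
      ... | inj₂ (inj₁ refl) = ∈₁
      ... | inj₂ (inj₂ (inj₁ refl)) = contradiction (∈∩₂ {A = A} x∈) e∉h
      ... | inj₂ (inj₂ (inj₂ refl)) = ∈₂
    ...   | no a∉f | no b∉f | yes ef =
      ≤-trans (excess-⊆ sub) (≤-trans (m≤n+m _ (excess f (⁅ b ⁆ ∪ ⁅ c ⁆))) (≤-trans
        (m≤n+m _ (excess f (⁅ a ⁆ ∪ ⁅ c ⁆))) (m≤n+m _ (excess f P))))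
      where
      sub : A ∩ E f ⊆ ⁅ e ⁆ ∪ ⁅ c ⁆
      sub x∈ with ∈A⁻ (∈∩₁ x∈)
      ... | inj₁ refl = contradiction (∈∩₂ {A = A} x∈) a∉f
      ... | inj₂ (inj₁ refl) = contradiction (∈∩₂ {A = A} x∈) b∉f
      ... | inj₂ (inj₂ (inj₁ refl)) = ∈₁
      ... | inj₂ (inj₂ (inj₂ refl)) = ∈₂
    ...   | no a∉f | no b∉f | no e∉f = ≤-trans (≤-reflexive (m≤n⇒m∸n≡0 (≤-trans
        (p⊆q⇒∣p∣≤∣q∣ sub) (≤-trans (≤-reflexive (∣⁅x⁆∣≡1 c)) (t-positive f))))) z≤n
      where
      sub : A ∩ E f ⊆ ⁅ c ⁆
      sub x∈ with ∈A⁻ (∈∩₁ x∈)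
      ... | inj₁ refl = contradiction (∈∩₂ {A = A} x∈) a∉f
      ... | inj₂ (inj₁ refl) = contradiction (∈∩₂ {A = A} x∈) b∉f
      ... | inj₂ (inj₂ (inj₁ refl)) = contradiction (∈∩₂ {A = A} x∈) e∉f
      ... | inj₂ (inj₂ (inj₂ refl)) = x∈⁅x⁆ c

    ∑bound : sum bound ≡ 5
    ∑bound = begin
      sum bound                                          ≡⟨ ∑-distrib-+ (λ f → excess f P) (λ f → ac⁺ f + (bc⁺ f + ec⁺ f)) ⟩
      sum (λ f → excess f P) + sum (λ f → ac⁺ f + (bc⁺ f + ec⁺ f))
        ≡⟨ cong (sum (λ f → excess f P) +_) (∑-distrib-+ ac⁺ (λ f → bc⁺ f + ec⁺ f)) ⟩
      sum (λ f → excess f P) + (sum ac⁺ + sum (λ f → bc⁺ f + ec⁺ f))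
        ≡⟨ cong (λ s → sum (λ f → excess f P) + (sum ac⁺ + s)) (∑-distrib-+ bc⁺ ec⁺) ⟩
      sum (λ f → excess f P) + (sum ac⁺ + (sum bc⁺ + sum ec⁺))
        ≡⟨ cong₂ _+_ (trans (excess-edge i P⊆i) (cong₂ _∸_ ∣P∣≡3 ti)) (cong₂ _+_ (excess-pair tj a≢c aj cj)
             (cong₂ _+_ (excess-pair th b≢c bh ch) (excess-pair tg e≢c eg cg))) ⟩
      5 ∎
      where
      open ≡-Reasoning
      ac⁺ bc⁺ ec⁺ : Fin n → ℕ
      ac⁺ f = excess f (⁅ a ⁆ ∪ ⁅ c ⁆)
      bc⁺ f = excess f (⁅ b ⁆ ∪ ⁅ c ⁆)
      ec⁺ f = excess f (⁅ e ⁆ ∪ ⁅ c ⁆)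

    six≤five : 6 ≤ 5
    six≤five =
      let l₁ , l₁≢l , 0<d₁ = second-colour i≢j i≢h j≢h ti tj th a≢b a≢c b≢c ai bi aj cj bh ch l
          l₂ , l₂≢l , 0<d₂ = second-colour i≢j i≢g j≢g ti tj tg a≢e a≢c e≢c ai ei aj cj eg cg l
          l₃ , l₃≢l , 0<d₃ = second-colour i≢h i≢g h≢g ti th tg b≢e b≢c e≢c bi ei bh ch eg cg l
      in begin
      6                       ≤⟨ six≤∑ l₁≢l l₂≢l l₃≢l 0<d₁ 0<d₂ 0<d₃ ⟩
      sum (λ l → d l A)       ≡⟨ nullity-sum prescribed ⟩
      sum (λ f → excess f A)  ≤⟨ sum-mono excess≤bound ⟩
      sum bound               ≡⟨ ∑bound ⟩
      5                       ∎
      where open ≤-Reasoning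

  -- The elements a, b, c become pairwise parallel. The pair a, c inside `E j` then lies in an edge
  -- of capacity 1, which (H2) identifies with j.
  proper-mixed : ∀ {l i j a} → i ≢ j → t i ≡ 1 → 1 < t j → Big i → Big j → a ∈ E i → a ∈ E j →
                 Good l i → Good l j → Empty.⊥
  proper-mixed {l} i≢j ti 1<tj big-i big-j ai aj good-i good-j =
    let b , c , bi , b≢a , cj , c≢a , bc = conflict i≢j big-i big-j ai aj good-i good-j
        ac = parallel-trans l (good⇒parallel good-i ti (b≢a ∘ sym) ai bi) bc (c≢a ∘ sym)
        h , th , ah , ch = parallel⇒edge ac (c≢a ∘ sym)
    in <⇒≢ 1<tj (sym (subst (λ f → t f ≡ 1) (same-edge (c≢a ∘ sym) ah ch aj cj) th))

  private
    conflict-≢ : ∀ {i j a b c} → i ≢ j → a ∈ E i → a ∈ E j → b ∈ E i → b ≢ a → c ∈ E j → b ≢ c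
    conflict-≢ i≢j ai aj bi b≢a cj refl = i≢j (same-edge b≢a bi ai cj aj)

  -- The parallel pair from `conflict` lies in an edge h of capacity 1 that also has colour l and
  -- meets i in b; `proper-mixed` applies to h and i.
  proper-higher : ∀ {l i j a} → i ≢ j → 1 < t i → Big i → Big j → a ∈ E i → a ∈ E j →
                  Good l i → Good l j → Empty.⊥
  proper-higher i≢j 1<ti big-i big-j ai aj good-i good-j =
    let b , c , bi , b≢a , cj , c≢a , bc = conflict i≢j big-i big-j ai aj good-i good-j
        b≢c = conflict-≢ i≢j ai aj bi b≢a cj
        h , th , bh , ch = parallel⇒edge bc b≢c
    in proper-mixed (λ h≡i → <⇒≢ 1<ti (sym (subst (λ f → t f ≡ 1) h≡i th))) th 1<ti
         (t≡1⇒big th b≢c bh ch) big-i bh bi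
         (parallel⇒good bc th b≢c bh ch) good-i

  -- If one of the edges has an element beyond its two corners, `no-triangle` applies; otherwise all
  -- three are pairs, against (H3).
  no-line-triangle : ∀ {l i j h a b c} → i ≢ j → t i ≡ 1 → t j ≡ 1 → t h ≡ 1 → a ≢ b → a ≢ c → b ≢ c →
                     a ∈ E i → b ∈ E i → a ∈ E j → c ∈ E j → b ∈ E h → c ∈ E h →
                     Good l i → Good l j → Good l h → Empty.⊥
  no-line-triangle {l} {i} {j} {h} {a} {b} {c} i≢j ti tj th a≢b a≢c b≢c ai bi aj cj bh ch good-i good-j good-h =
    third (⊆-witness (E i) (⁅ a ⁆ ∪ ⁅ b ⁆)) (⊆-witness (E j) (⁅ a ⁆ ∪ ⁅ c ⁆)) (⊆-witness (E h) (⁅ b ⁆ ∪ ⁅ c ⁆))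
    where
    i≢h : i ≢ h
    i≢h refl = i≢j (same-edge a≢c ai ch aj cj)
    j≢h : j ≢ h
    j≢h refl = i≢j (same-edge a≢b ai bi aj bh)
    ∉pair⁻ : ∀ {x y z : Fin m} → z ∉ ⁅ x ⁆ ∪ ⁅ y ⁆ → x ≢ z × y ≢ z
    ∉pair⁻ z∉ = (λ { refl → z∉ ∈₁ }) , (λ { refl → z∉ ∈₂ })
    third : E i ⊆ ⁅ a ⁆ ∪ ⁅ b ⁆ ⊎ ∃[ e ] e ∈ E i × e ∉ ⁅ a ⁆ ∪ ⁅ b ⁆ →
            E j ⊆ ⁅ a ⁆ ∪ ⁅ c ⁆ ⊎ ∃[ e ] e ∈ E j × e ∉ ⁅ a ⁆ ∪ ⁅ c ⁆ →
            E h ⊆ ⁅ b ⁆ ∪ ⁅ c ⁆ ⊎ ∃[ e ] e ∈ E h × e ∉ ⁅ b ⁆ ∪ ⁅ c ⁆ → Empty.⊥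
    third (inj₂ (e , ei , e∉)) _ _ =
      let a≢e , b≢e = ∉pair⁻ e∉
      in no-triangle i≢j i≢h j≢h ti tj th a≢b a≢c b≢c a≢e b≢e ai bi ei aj cj bh ch good-i good-j good-h
    third (inj₁ _) (inj₂ (e , ej , e∉)) _ =
      let a≢e , c≢e = ∉pair⁻ e∉
      in no-triangle (i≢j ∘ sym) j≢h i≢h tj ti th a≢c a≢b (b≢c ∘ sym) a≢e c≢e
           aj cj ej ai bi ch bh good-j good-i good-h
    third (inj₁ _) (inj₁ _) (inj₂ (e , eh , e∉)) =
      let b≢e , c≢e = ∉pair⁻ e∉
      in no-triangle (i≢h ∘ sym) (j≢h ∘ sym) i≢j th ti tj b≢c (a≢b ∘ sym) (a≢c ∘ sym) b≢e c≢e
           bh ch eh bi ai cj aj good-h good-i good-j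
    third (inj₁ i⊆) (inj₁ j⊆) (inj₁ h⊆) = h3 (a , b , c , a≢b , a≢c , b≢c ,
      (i , ⊆-antisym i⊆ (pair⊆ ai bi)) , (j , ⊆-antisym j⊆ (pair⊆ aj cj)) , (h , ⊆-antisym h⊆ (pair⊆ bh ch)))

  proper-big : ∀ {l i j a} → i ≢ j → Big i → Big j → a ∈ E i → a ∈ E j → Good l i → Good l j → Empty.⊥
  proper-big {i = i} {j} i≢j big-i big-j ai aj good-i good-j
    with m≤n⇒m<n∨m≡n (t-positive i) | m≤n⇒m<n∨m≡n (t-positive j)
  ... | inj₁ 1<ti | _         = proper-higher i≢j 1<ti big-i big-j ai aj good-i good-j
  ... | inj₂ _    | inj₁ 1<tj = proper-higher (i≢j ∘ sym) 1<tj big-j big-i aj ai good-j good-i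
  ... | inj₂ 1≡ti | inj₂ 1≡tj =
    let b , c , bi , b≢a , cj , c≢a , bc = conflict i≢j big-i big-j ai aj good-i good-j
        b≢c = conflict-≢ i≢j ai aj bi b≢a cj
        h , th , bh , ch = parallel⇒edge bc b≢c
    in no-line-triangle i≢j (sym 1≡ti) (sym 1≡tj) th (b≢a ∘ sym) (c≢a ∘ sym) b≢c ai bi aj cj bh ch
         good-i good-j (parallel⇒good bc th b≢c bh ch)

  -- Dropping a loop from a `(t i + 1)`-subset would preserve its nullity, but the remaining `t i`
  -- elements are independent.
  big⇒nonloop : ∀ {l i e} → Big i → Good l i → e ∈ E i → 0 < v l e
  big⇒nonloop {l} {i} {e} big good e∈Ei =
    let A , e⊆A , A⊆Ei , ∣A∣≡ = intermediate ⁅ e ⁆ (E i) (suc (t i)) (⁅⁆⊆ e∈Ei)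
                                   (≤-trans (≤-reflexive (∣⁅x⁆∣≡1 e)) (s≤s z≤n)) big
        e∈A = e⊆A (x∈⁅x⁆ e)
    in ≤-trans (good-circuit good A⊆Ei ∣A∣≡) (≤-trans (d-remove l e∈A) (≤-reflexive
         (cong (_+ v l e) (edge-independent i l (λ y∈ → A⊆Ei (p─q⊆p A _ y∈))
           (≤-reflexive (suc-injective (trans (∣-x∣ e∈A) ∣A∣≡)))))))

  -- Colours for singleton edges

  big? : ∀ i → Dec (Big i)
  big? i = t i <? ∣ E i ∣

  small⇒∣∣≤1 : ∀ {i} → ¬ Big i → ∣ E i ∣ ≤ 1
  small⇒∣∣≤1 {i} small with condT i
  ... | inj₁ t≡1       = ≤-trans (≮⇒≥ small) (≤-reflexive t≡1)
  ... | inj₂ (_ , big) = contradiction big small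

  Unclaimed : Fin k → Fin n → Set
  Unclaimed l i = ∀ {h e} → Big h → e ∈ E i → e ∈ E h → ¬ Good l h

  -- The big edges through the only element e of E i have distinct colours, and there are fewer of
  -- them than colours in which e is not a loop.
  small-colour : ∀ i → ¬ Big i → ∃[ l ] (∀ {e} → e ∈ E i → 0 < v l e) × Unclaimed l i
  small-colour i small = proj₁ spare , nonloop , unclaimed
    where
    e : Fin m
    e = proj₁ (X-nonempty i)
    e∈Ei : e ∈ E i
    e∈Ei = proj₂ (X-nonempty i)
    only-e : ∀ {x} → x ∈ E i → x ≡ e
    only-e x∈Ei = ∣∣≤1⇒≡ (small⇒∣∣≤1 small) x∈Ei e∈Ei

    claims? : ∀ l h → Dec (Big h × e ∈ E h × Good l h)
    claims? l h = big? h ×-dec (e ∈? E h) ×-dec (∣ E h ∣ ≤? d l (E h) + t h)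
    claim : Fin k → Fin n → ℕ
    claim l h = 𝟙 (claims? l h)
    claim⁻ : ∀ l h → 0 < claim l h → Big h × e ∈ E h × Good l h
    claim⁻ l h = 𝟙-pos⁻ (claims? l h)

    ∑claim≤ : ∀ h → sum (λ l → claim l h) ≤ ∣ ⁅ e ⁆ ∩ E h ∣
    ∑claim≤ h = sum≤bound (λ l → claim l h) _ ≤size λ {l} {l′} l≢l′ 0<c 0<c′ →
      let big , _ , good = claim⁻ l h 0<c
          _ , _ , good′  = claim⁻ l′ h 0<c′
      in l≢l′ (good-unique big good good′)
      where
      ≤size : ∀ l → claim l h ≤ ∣ ⁅ e ⁆ ∩ E h ∣
      ≤size l = 𝟙≤ (claims? l h) λ (_ , e∈Eh , _) → ≤-reflexive (sym (∣⁅⁆∩∣-∈ e∈Eh))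

    -- The edge i counts towards the degree of e but makes no claim; this is the surplus that leaves
    -- a colour free.
    ∑claim-i : sum (λ l → claim l i) < ∣ ⁅ e ⁆ ∩ E i ∣
    ∑claim-i = subst₂ _<_ (sym (trans (sum-cong-≗ zeros) (sum-replicate-zero k)))
      (sym (∣⁅⁆∩∣-∈ e∈Ei)) (s≤s z≤n)
      where
      zeros : ∀ l → claim l i ≡ 0
      zeros l = n≤0⇒n≡0 (≮⇒≥ λ 0<claim → small (proj₁ (claim⁻ l i 0<claim)))

    spare : ∃[ l ] sum (claim l) < v l e
    spare = sum-<⇒∃ (λ l → sum (claim l)) (λ l → v l e) (begin-strict
      sum (λ l → sum (claim l))           ≡⟨ ∑-comm claim ⟩
      sum (λ h → sum (λ l → claim l h))   <⟨ sum-mono-< ∑claim≤ i ∑claim-i ⟩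
      sum (λ h → ∣ ⁅ e ⁆ ∩ E h ∣)         ≡⟨ v-sum e ⟨
      sum (λ l → v l e)                   ∎)
      where open ≤-Reasoning
    l₀ : Fin k
    l₀ = proj₁ spare
    nonloop : ∀ {x} → x ∈ E i → 0 < v l₀ x
    nonloop x∈Ei = subst (λ x → 0 < v l₀ x) (sym (only-e x∈Ei)) (≤-<-trans z≤n (proj₂ spare))
    -- As `v l₀ e ≤ 1`, the strict inequality in `spare` leaves no claim on `l₀`.
    unclaimed : Unclaimed l₀ i
    unclaimed {h} {x} big x∈Ei x∈Eh good = contradiction
      (≤-trans (𝟙-pos⁺ (claims? l₀ h) (big , subst (_∈ E h) (only-e x∈Ei) x∈Eh , good)) (term≤sum (claim l₀) h))
      (<⇒≱ (<-≤-trans (proj₂ spare) (v≤1 l₀ e)))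

  -- For a singleton edge `good` holds in every colour, so the choice of colour rests on `nonloop`
  -- and `Unclaimed`.
  record Assigned (l : Fin k) (i : Fin n) : Set where
    field
      good    : Good l i
      nonloop : ∀ {e} → e ∈ E i → 0 < v l e
      kind    : Big i ⊎ (¬ Big i × Unclaimed l i)
  open Assigned

  abstract
    assign : ∀ i → ∃[ l ] Assigned l i
    assign i with big? i
    ... | yes big =
      let l , good = good-exists big
      in l , record { good = good ; nonloop = big⇒nonloop big good ; kind = inj₁ big }
    ... | no small =
      let l , nonloop , unclaimed = small-colour i small
      in l , record { good    = ≤-trans (≮⇒≥ small) (m≤n+m (t i) (d l (E i)))
                    ; nonloop = nonloop
                    ; kind    = inj₂ (small , unclaimed) }

  -- A big and a small edge are kept apart by `Unclaimed`, two big ones by `proper-big`. Two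
  -- singletons through a are the same set, hence the same index.
  assigned-proper : ∀ {l i j a} → Assigned l i → Assigned l j → a ∈ E i → a ∈ E j → i ≡ j
  assigned-proper {i = i} {j} as-i as-j ai aj with kind as-i | kind as-j
  ... | inj₁ big-i           | inj₂ (_ , unclaimed)  = contradiction (good as-i) (unclaimed big-i aj ai)
  ... | inj₂ (_ , unclaimed) | inj₁ big-j            = contradiction (good as-j) (unclaimed big-j ai aj)
  ... | inj₂ (small-i , _)   | inj₂ (small-j , _)    = X-injective (⊆-antisym
    (λ x∈ → subst (_∈ E j) (∣∣≤1⇒≡ (small⇒∣∣≤1 small-i) ai x∈) aj)
    (λ x∈ → subst (_∈ E i) (∣∣≤1⇒≡ (small⇒∣∣≤1 small-j) aj x∈) ai))
  ... | inj₁ big-i           | inj₁ big-j with i Fin.≟ j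
  ...   | yes i≡j = i≡j
  ...   | no i≢j  = contradiction (good as-j) (proper-big i≢j big-i big-j ai aj (good as-i))

  -- The colouring and the loops it determines

  colouring : ProperColouring (lineGraph H) k
  colouring = record
    { colour = λ i → proj₁ (assign i)
    ; proper = λ {i} {j} (i≢j , a , a∈) same → i≢j (assigned-proper
        (subst (λ l → Assigned l i) same (proj₂ (assign i))) (proj₂ (assign j))
        (∈∩₁ a∈) (∈∩₂ {A = E i} a∈)) }

  open ProperColouring colouring using (colour; class; c₁; c₂⁺)

  assigned : ∀ {l i} → colour i ≡ l → Assigned l i
  assigned {i = i} refl = proj₂ (assign i)

  -- At most one edge of colour l contains e, and it makes e a non-loop, so the number of such edges
  -- is at most `v l e`. Summed over l, both sides give the degree of e, so they agree in every
  -- colour.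
  loop : ∀ {l e} → (∀ {i} → colour i ≡ l → e ∉ E i) → v l e ≡ 0
  loop {l} {e} e∉ = trans (sym (sum-tight {f = λ l → sum (u l)} {λ l → v l e} u≤v ∑v≤∑u l))
    (trans (sum-cong-≗ zeros) (sum-replicate-zero n))
    where
    u : Fin k → Fin n → ℕ
    u l i = if does (colour i Fin.≟ l) then ∣ ⁅ e ⁆ ∩ E i ∣ else 0
    size⁻ : ∀ {i} → 0 < ∣ ⁅ e ⁆ ∩ E i ∣ → e ∈ E i
    size⁻ {i} 0<size =
      let x , x∈ = 0<∣∣⇒nonempty (⁅ e ⁆ ∩ E i) 0<size
      in subst (_∈ E i) (x∈⁅y⁆⇒x≡y e (∈∩₁ x∈)) (∈∩₂ {A = ⁅ e ⁆} x∈)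
    u⁻ : ∀ l i → 0 < u l i → colour i ≡ l × e ∈ E i
    u⁻ l i 0<u with colour i Fin.≟ l
    ... | yes eq = eq , size⁻ 0<u
    u≤1 : ∀ l i → u l i ≤ 1
    u≤1 l i with colour i Fin.≟ l
    ... | yes _ = ≤-trans (∣p∩q∣≤∣p∣ ⁅ e ⁆ (E i)) (≤-reflexive (∣⁅x⁆∣≡1 e))
    ... | no _  = z≤n
    u≤v′ : ∀ l i → u l i ≤ v l e
    u≤v′ l i with u l i | u≤1 l i | u⁻ l i
    ... | zero  | _  | _       = z≤n
    ... | suc _ | ≤1 | witness =
      let eq , e∈Ei = witness (s≤s z≤n) in ≤-trans ≤1 (nonloop (assigned eq) e∈Ei)
    u≤v : ∀ l → sum (u l) ≤ v l e
    u≤v l = sum≤bound (u l) (v l e) (u≤v′ l) λ {i} {j} i≢j 0<u 0<u′ →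
      let i≡l , ei = u⁻ l i 0<u
          j≡l , ej = u⁻ l j 0<u′
      in i≢j (assigned-proper (assigned i≡l) (assigned j≡l) ei ej)
    ∑v≤∑u : sum (λ l → v l e) ≤ sum (λ l → sum (u l))
    ∑v≤∑u = ≤-reflexive (begin
      sum (λ l → v l e)                  ≡⟨ v-sum e ⟩
      sum (λ i → ∣ ⁅ e ⁆ ∩ E i ∣)        ≡⟨ sum-cong-≗ (λ i → sum-at (colour i) ∣ ⁅ e ⁆ ∩ E i ∣) ⟨
      sum (λ i → sum (λ l → u l i))      ≡⟨ ∑-comm u ⟨
      sum (λ l → sum (u l))              ∎)
      where open ≡-Reasoning
    zeros : ∀ i → u l i ≡ 0
    zeros i = n≤0⇒n≡0 (≮⇒≥ λ 0<u → let i≡l , ei = u⁻ l i 0<u in e∉ i≡l ei)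

  -- Rank bounds from the colour classes

  assigned-rank : ∀ {l i} A → Assigned l i → r l (A ∩ E i) ≤ ∣ A ∩ E i ∣ ⊓ t i
  assigned-rank {l} {i} A as = ⊓-glb (Matroid.rank≤size (N l) ⊆⊤)
    (≤-trans (r-mono l (∈∩₂ {A = A})) (+-cancelˡ-≤ (d l (E i)) _ _ (begin
      d l (E i) + r l (E i)  ≡⟨ +-comm (d l (E i)) (r l (E i)) ⟩
      r l (E i) + d l (E i)  ≡⟨ r+d≡s l (E i) ⟩
      s l (E i)              ≤⟨ s≤size l (E i) ⟩
      ∣ E i ∣                ≤⟨ good as ⟩
      d l (E i) + t i        ∎)))
    where open ≤-Reasoning

  rank-⋃ : ∀ {l} A (hs : List (Fin n)) → r l (A ∩ ⋃ (List.map E hs)) ≤ ∑[ (λ h → r l (A ∩ E h)) ] hs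
  rank-⋃ {l} A []       = ≤-reflexive (trans (cong (r l) (∩-zeroʳ A)) (r-⊥ l))
  rank-⋃ {l} A (h ∷ hs) = begin
    r l (A ∩ (E h ∪ U))             ≡⟨ cong (r l) (∩-distribˡ-∪ A (E h) U) ⟩
    r l ((A ∩ E h) ∪ (A ∩ U))       ≤⟨ r-subadditive l (A ∩ E h) (A ∩ U) ⟩
    r l (A ∩ E h) + r l (A ∩ U)     ≤⟨ +-monoʳ-≤ (r l (A ∩ E h)) (rank-⋃ A hs) ⟩
    r l (A ∩ E h) + ∑[ (λ h → r l (A ∩ E h)) ] hs ∎
    where
    open ≤-Reasoning
    U : Subset m
    U = ⋃ (List.map E hs)

  class⁻ : ∀ l → All.All (λ i → colour i ≡ l) (class l)
  class⁻ l = AllProperties.all-filter (λ i → colour i Fin.≟ l) (allFin n)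

  -- Elements outside the union of the class are loops, so subadditivity leaves only the
  -- contributions of its edges.
  rank-class : ∀ l A → r l A ≤ ∑[ (λ h → ∣ A ∩ E h ∣ ⊓ t h) ] (class l)
  rank-class l A = begin
    r l A                                        ≤⟨ r-mono l split ⟩
    r l ((A ∩ Z) ∪ (A ─ Z))                      ≤⟨ r-subadditive l (A ∩ Z) (A ─ Z) ⟩
    r l (A ∩ Z) + r l (A ─ Z)                    ≤⟨ +-mono-≤ (rank-⋃ A (class l)) (≤-trans (r≤s l (A ─ Z)) loops) ⟩
    ∑[ (λ h → r l (A ∩ E h)) ] (class l) + 0     ≡⟨ +-identityʳ _ ⟩
    ∑[ (λ h → r l (A ∩ E h)) ] (class l)         ≤⟨ bound (class⁻ l) ⟩
    ∑[ (λ h → ∣ A ∩ E h ∣ ⊓ t h) ] (class l)     ∎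
    where
    open ≤-Reasoning
    Z : Subset m
    Z = ⋃ (List.map E (class l))
    split : A ⊆ (A ∩ Z) ∪ (A ─ Z)
    split {x} x∈A with x ∈? Z
    ... | yes x∈Z = ∈∪₁ (∈∩ x∈A x∈Z)
    ... | no x∉Z  = ∈∪₂ {A = A ∩ Z} (x∈p∧x∉q⇒x∈p─q x∈A x∉Z)
    in-class : ∀ {i} → colour i ≡ l → E i ⊆ Z
    in-class {i} eq = ∈-⋃ E (∈-filter⁺ (λ i → colour i Fin.≟ l) (∈-allFin i) eq)
    loops : s l (A ─ Z) ≤ 0
    loops = ≤-trans (weight-mono {v = const 0} (A ─ Z) λ x∈ → ≤-reflexive (loop λ eq x∈Ei →
      ∈─⁻ {A = A} x∈ (in-class eq x∈Ei))) (≤-reflexive (trans (weight-const 0 (A ─ Z)) (*-zeroʳ ∣ A ─ Z ∣)))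
    bound : ∀ {hs} → All.All (λ i → colour i ≡ l) hs →
            ∑[ (λ h → r l (A ∩ E h)) ] hs ≤ ∑[ (λ h → ∣ A ∩ E h ∣ ⊓ t h) ] hs
    bound []         = z≤n
    bound (eq ∷ eqs) = +-mono-≤ (assigned-rank A (assigned eq)) (bound eqs)

  rank≥1 : ∀ {l i} → Assigned l i → 1 ≤ r l ⊤
  rank≥1 {l} {i} as = ≤-trans (nonloop as (proj₂ (X-nonempty i))) (r-mono l ⊆⊤)

  -- Elements e and f of the two edges are distinct because the edges are disjoint. If they were
  -- parallel, an edge of capacity 1 and colour l would contain both and so coincide with i and with
  -- j.
  rank≥2 : ∀ {l i j} → i ≢ j → Assigned l i → Assigned l j → 2 ≤ r l ⊤
  rank≥2 {l} {i} {j} i≢j as-i as-j = begin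
    2                        ≤⟨ +-mono-≤ (nonloop as-i ei) (nonloop as-j fj) ⟩
    v l e + v l f            ≡⟨ cong (_+ v l f) (weight-⁅⁆ (v l) e) ⟨
    s l ⁅ e ⁆ + v l f        ≡⟨ weight-disjoint (v l) ⁅ e ⁆ (λ f∈ → e≢f (sym (x∈⁅y⁆⇒x≡y e f∈))) ⟨
    s l S                    ≡⟨ r+d≡s l S ⟨
    r l S + d l S            ≡⟨ cong (r l S +_) (n≤0⇒n≡0 (≮⇒≥ not-parallel)) ⟩
    r l S + 0                ≡⟨ +-identityʳ (r l S) ⟩
    r l S                    ≤⟨ r-mono l ⊆⊤ ⟩
    r l ⊤                    ∎
    where
    open ≤-Reasoning
    e f : Fin m
    e = proj₁ (X-nonempty i)
    f = proj₁ (X-nonempty j)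
    ei : e ∈ E i
    ei = proj₂ (X-nonempty i)
    fj : f ∈ E j
    fj = proj₂ (X-nonempty j)
    e≢f : e ≢ f
    e≢f e≡f = i≢j (assigned-proper as-i as-j ei (subst (_∈ E j) (sym e≡f) fj))
    S : Subset m
    S = ⁅ e ⁆ ∪ ⁅ f ⁆
    not-parallel : ¬ Parallel l e f
    not-parallel par =
      let h , th , eh , fh = parallel⇒edge par e≢f
          big = t≡1⇒big th e≢f eh fh
          as-h = assigned (good-unique big (good (assigned {i = h} refl)) (parallel⇒good par th e≢f eh fh))
      in i≢j (trans (assigned-proper as-i as-h ei eh) (assigned-proper as-h as-j fh fj))

  class-rank : ∀ l → List.length (class l) ⊓ 2 ≤ r l ⊤
  class-rank l = go (class⁻ l) (Unique.filter⁺ (λ i → colour i Fin.≟ l) (Unique.allFin⁺ n))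
    where
    go : ∀ {hs} → All.All (λ i → colour i ≡ l) hs → Unique hs → List.length hs ⊓ 2 ≤ r l ⊤
    go []             _                 = z≤n
    go (eq ∷ [])      _                 = rank≥1 (assigned eq)
    go {_ ∷ _ ∷ hs} (eq ∷ eq′ ∷ eqs) ((h≢h′ ∷ _) ∷ _) =
      ≤-trans (m⊓n≤n (2 + List.length hs) 2) (rank≥2 h≢h′ (assigned eq) (assigned eq′))

  rank-total : c₁ + 2 * c₂⁺ ≤ sum (λ l → r l ⊤)
  rank-total = begin
    c₁ + 2 * c₂⁺                                   ≡⟨ cong₂ (λ p q → p + 2 * q) (count≡sum one?) (count≡sum two?) ⟩
    sum [one] + 2 * sum [two]                      ≡⟨ cong (λ q → sum [one] + (sum [two] + q)) (+-identityʳ (sum [two])) ⟩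
    sum [one] + (sum [two] + sum [two])            ≡⟨ cong (sum [one] +_) (∑-distrib-+ [two] [two]) ⟨
    sum [one] + sum (λ l → [two] l + [two] l)      ≡⟨ ∑-distrib-+ [one] (λ l → [two] l + [two] l) ⟨
    sum (λ l → [one] l + ([two] l + [two] l))      ≤⟨ sum-mono (λ l → ≤-trans (termwise l) (class-rank l)) ⟩
    sum (λ l → r l ⊤)                              ∎
    where
    open ≤-Reasoning
    one? : ∀ l → Dec (List.length (class l) ≡ 1)
    one? l = List.length (class l) ≟ 1
    two? : ∀ l → Dec (2 ≤ List.length (class l))
    two? l = 2 ≤? List.length (class l)
    [one] [two] : Fin k → ℕ
    [one] l = 𝟙 (one? l)
    [two] l = 𝟙 (two? l)
    small : ∀ s → 𝟙 (s ≟ 1) + (𝟙 (2 ≤? s) + 𝟙 (2 ≤? s)) ≤ s ⊓ 2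
    small 0             = z≤n
    small 1             = ≤-refl
    small (suc (suc s)) = s≤s (s≤s z≤n)
    termwise : ∀ l → [one] l + ([two] l + [two] l) ≤ List.length (class l) ⊓ 2
    termwise l = small (List.length (class l))

  used? : ∀ l → Dec (0 < List.length (class l))
  used? l = 0 <? List.length (class l)

  used : List (Fin k)
  used = filter used? (allFin k)

  colour∈used : ∀ i → colour i Membership.∈ used
  colour∈used i = ∈-filter⁺ used? (∈-allFin (colour i))
    (∈-length (∈-filter⁺ (λ j → colour j Fin.≟ colour i) (∈-allFin i) refl))

  -- Matroids of rank 0 can pad a decomposition, so k is not bounded by the total rank. The number
  -- of nonempty classes is, since each forces rank at least 1; numbering colours by their position
  -- in `used` gives a colouring to compare with χ.
  used-colouring : ProperColouring (lineGraph H) (List.length used)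
  used-colouring = record
    { colour = λ i → Any.index (colour∈used i)
    ; proper = λ adj same → ProperColouring.proper colouring adj
        (index-injective (setoid _) (colour∈used _) (colour∈used _) same) }

  used≤rank : List.length used ≤ sum (λ l → r l ⊤)
  used≤rank = begin
    List.length used                               ≡⟨ count≡sum used? ⟩
    sum (λ l → 𝟙 (used? l))                        ≤⟨ sum-mono (λ l → ≤-trans (small (List.length (class l)))
                                                                             (class-rank l)) ⟩
    sum (λ l → r l ⊤)                              ∎
    where
    open ≤-Reasoning
    small : ∀ s → 𝟙 (0 <? s) ≤ s ⊓ 2
    small 0             = z≤n
    small 1             = ≤-refl
    small (suc (suc s)) = s≤s z≤n

-- Ranks of the matroids produced by `φ`

module _ {m n : ℕ} (H : Hypergraph m n) (t : Fin n → ℕ) (t≤ : ∀ i → t i ≤ ∣ X H i ∣) where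

  -- `directSum` restricts its argument again at each summand. Letting `A` range between `B` and the
  -- part of `B` inside the ground set makes the induction absorb these restrictions.
  rank-⨁ : ∀ {A B : Subset m} hs (disj : PairwiseDisjoint (X H) hs) → A ⊆ B →
           B ∩ ⋃ (List.map (X H) hs) ⊆ A →
           rank (⨁ (λ h → uniform (t h) (X H h) (t≤ h)) hs disj) A ≡
           ∑[ (λ h → ∣ B ∩ X H h ∣ ⊓ t h) ] hs
  rank-⨁ {A} [] [] _ _ = ⊓-zeroʳ ∣ A ∣
  rank-⨁ {A} {B} (h ∷ hs) (_ ∷ disj) A⊆B B⊆A = cong₂ _+_
    (cong (λ S → ∣ S ∣ ⊓ t h) (⊆-antisym
      (λ x∈ → ∈∩ (A⊆B (∈∩₁ x∈)) (∈∩₂ {A = A} x∈))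
      (λ x∈ → ∈∩ (B⊆A (∈∩ (∈∩₁ x∈) (∈∪₁ (∈∩₂ {A = B} x∈)))) (∈∩₂ {A = B} x∈))))
    (rank-⨁ hs disj (λ x∈ → A⊆B (∈∩₁ x∈))
      λ x∈ → ∈∩ (B⊆A (∈∩ (∈∩₁ x∈) (∈∪₂ {A = X H h} (∈∩₂ {A = B} x∈)))) (∈∩₂ {A = B} x∈))

  module _ {k : ℕ} (c : ProperColouring (lineGraph H) k) where
    open ProperColouring c using (colour; class)

    rank-φ : ∀ l A → rank (φ H t t≤ c l) A ≡ ∑[ (λ h → ∣ A ∩ X H h ∣ ⊓ t h) ] (class l)
    rank-φ l A = trans
      (cong₂ _+_ (rank-⨁ (class l) (class-disjoint H c l) ∈∩₁ id) (⊓-zeroʳ ∣ A ∩ ∁ _ ∣))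
      (+-identityʳ _)

    ∑rank-φ : ∀ A → sum (λ l → rank (φ H t t≤ c l) A) ≡ sum (λ i → ∣ A ∩ X H i ∣ ⊓ t i)
    ∑rank-φ A = begin
      sum (λ l → rank (φ H t t≤ c l) A)      ≡⟨ sum-cong-≗ (λ l → trans (rank-φ l A)
                                                  (∑-filter (λ i → colour i Fin.≟ l) f)) ⟩
      sum (λ l → sum (λ i → if does (colour i Fin.≟ l) then f i else 0))
                                             ≡⟨ ∑-comm (λ l i → if does (colour i Fin.≟ l) then f i else 0) ⟩
      sum (λ i → sum (λ l → if does (colour i Fin.≟ l) then f i else 0))
                                             ≡⟨ sum-cong-≗ (λ i → sum-at (colour i) (f i)) ⟩
      sum f                                  ∎
      where
      open ≡-Reasoning
      f : Fin n → ℕ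
      f i = ∣ A ∩ X H i ∣ ⊓ t i

-- Opened only here, so that the prefix +_ does not clash with the sections of _+_ above.
open import Data.Integer using (ℤ; +_)
import Data.Integer as ℤ
import Data.Integer.Properties as ℤ
open ProperColouring using (c₁; c₂⁺)

theorem2p9 : ∀ {m n : ℕ} (H : Hypergraph m n) (t : Fin n → ℕ)
    (t≤ : ∀ i → t i ≤ ∣ X H i ∣) →
    H2 H → H3 H → CondT H t →
    (σ : Subset m → ℤ) → IsPolymatroid σ →
    (∀ A → Prescribed H t A → σ A ≡ ρ H t A) →
    (∀ (k : ℕ) → 0 < k →
    (∀ (N : Fin k → Matroid {m} ⊤) → N ∈Δ σ →
    ∃[ c ] + (c₁ {G = lineGraph H} {k = k} c + 2 * c₂⁺ c) ℤ.≤ σ ⊤)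
    × ((∀ A → σ A ≡ ρ H t A) →
    ∀ (N : Fin k → Matroid {m} ⊤) →
    (∃[ c ] (∀ l → φ H t t≤ c l ≈ᴹ N l)) ⇔ N ∈Δ ρ H t))
    × (∀ (χ : ℕ) → IsChromaticNumber (lineGraph H) χ → σ ⊤ ℤ.< + χ → Indecomposable σ)
theorem2p9 {m} {n} H t t≤ h2 h3 condT σ _ σ≡ρ =
  (λ k _ → (λ N N∈Δ → let open Colouring N (rank-sum N N∈Δ) in
                       colouring , subst (+ (c₁ colouring + 2 * c₂⁺ colouring) ℤ.≤_)
                         (sym (N∈Δ ⊤)) (ℤ.+≤+ rank-total))
         , λ _ N → mk⇔ (image N) (decompose N))
  , λ χ (_ , least) σ<χ (k , N , N∈Δ) → let open Colouring N (rank-sum N N∈Δ) in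
      ℤ.<⇒≱ σ<χ (subst (+ χ ℤ.≤_) (sym (N∈Δ ⊤))
        (ℤ.+≤+ (≤-trans (least (List.length used) used-colouring) used≤rank)))
  where
  module Colouring {k : ℕ} = Decomposition {m} {n} {k} H t h2 h3 condT

  rank-sum : ∀ {k} (N : Fin k → Matroid {m} ⊤) → N ∈Δ σ → ∀ A → Prescribed H t A →
             sum (λ l → rank (N l) A) ≡ sum (λ i → ∣ A ∩ X H i ∣ ⊓ t i)
  rank-sum N N∈Δ A pre = ℤ.+-injective (trans (sym (N∈Δ A)) (σ≡ρ A pre))

  image : ∀ {k} (N : Fin k → Matroid {m} ⊤) → ∃[ c ] (∀ l → φ H t t≤ c l ≈ᴹ N l) → N ∈Δ ρ H t
  image N (c , φ≈N) A = cong +_ (trans (sym (∑rank-φ H t t≤ c A)) (sum-cong-≗ λ l → φ≈N l ⊆⊤))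

  decompose : ∀ {k} (N : Fin k → Matroid {m} ⊤) → N ∈Δ ρ H t → ∃[ c ] (∀ l → φ H t t≤ c l ≈ᴹ N l)
  -- The bounds `rank-class` add up to `ρ` on `A`, as do the ranks of `N`, so no colour has any
  -- slack.
  decompose N N∈Δ = colouring , λ l {A} _ → sym (sum-tight
      (λ l → ≤-trans (rank-class l A) (≤-reflexive (sym (rank-φ H t t≤ colouring l A))))
      (≤-reflexive (trans (∑rank-φ H t t≤ colouring A) (sym (∑rank≡ A)))) l)
    where
    ∑rank≡ : ∀ A → sum (λ l → rank (N l) A) ≡ sum (λ i → ∣ A ∩ X H i ∣ ⊓ t i)
    ∑rank≡ A = ℤ.+-injective (sym (N∈Δ A))
    open Colouring N (λ A _ → ∑rank≡ A)
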